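{- Let $G$ be a graph with $m\ge 1$ edges and minimum degree $\delta$, and let $\alpha>0$ be real. Then $$SDD_{\alpha}(G)\ge\frac{\delta^{\alpha}m^2}{ISD_{ -\alpha}(G)},$$ and equality is attained if and only if $G$ is regular.
   Context: Graphs are finite, simple and undirected. For a graph $G$ with edge set $E(G)$, $d_u$ denotes the degree of the vertex $u$, and $uv$ denotes the edge joining $u$ and $v$. For $\alpha\in\mathbb{R}$, the variable symmetric division deg index is $$SDD_\alpha(G)=\sum_{uv\in E(G)}\left(\frac{d_u^\alpha}{d_v^\alpha}+\frac{d_v^\alpha}{d_u^\alpha}\right).$$ For $a\in\mathbb{R}$, the variable inverse sum deg index is $$ISD_a(G)=\sum_{uv\in E(G)}\frac{1}{d_u^a+d_v^a}.$$ A graph is regular if all its vertices have the same degree. -}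

module Defs where

open import Level using (0ℓ)
open import Algebra.Bundles using (CommutativeRing)
import Algebra.Properties.CommutativeSemiring.Exp as Exp
open import Data.Empty using (⊥-elim)
open import Data.Fin as Fin using (Fin)
import Data.Fin.Properties as Fin
open import Data.Integer as ℤ using (ℤ; +_; -[1+_])
import Data.Integer.Properties as ℤ
open import Data.List using (List; []; _∷_; length; filter; foldr; mapMaybe; allFin; cartesianProduct)
open import Data.List.Membership.Propositional.Properties using (∈-filter⁺; ∈-allFin; ∈-length)
open import Data.Maybe as Maybe using (Maybe)
open import Data.Nat as ℕ using (ℕ; zero; suc)
import Data.Nat.Properties as ℕ
open import Data.Product using (∃-syntax; _×_; _,_)
open import Data.Rational as ℚ using (ℚ; 0ℚ; 1ℚ; ½; ↥_; ↧ₙ_)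
import Data.Rational.Properties as ℚ
open import Data.Rational.Solver using (module +-*-Solver)
import Data.Nat.Solver as ℕSolver
import Data.Integer.Solver as ℤSolver
open import Data.Rational.Unnormalised as ℚᵘ using (mkℚᵘ)
import Data.Rational.Unnormalised.Properties as ℚᵘ
open import Data.Sum using (inj₁; inj₂)
open import Relation.Binary.Core using (Rel)
open import Relation.Binary.Definitions using (Decidable; Symmetric)
open import Relation.Binary.PropositionalEquality
open import Relation.Nullary using (¬_; yes; no)
open import Relation.Nullary.Decidable using (dec⇒maybe; _×-dec_)
import Relation.Unary as U

open Exp (CommutativeRing.commutativeSemiring ℚ.+-*-commutativeRing) public
  using ()
  renaming ( _^_ to _^ℚ_; ^-homo-* to ^ℚ-homo-*; ^-assocʳ to ^ℚ-assocʳ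
           ; ^-distrib-* to ^ℚ-distrib-* )

infixr 8 _^ᶻ_

_^ᶻ_ : (b : ℚ) .{{_ : ℚ.NonZero b}} → ℤ → ℚ
b ^ᶻ (+ p)    = b ^ℚ p
b ^ᶻ -[1+ p ] = (ℚ.1/ b) ^ℚ suc p

fromℕℚ : ℕ → ℚ
fromℕℚ n = + n ℚ./ 1

-- The junk value at 0 never matters: a real is inverted only when it is
-- positive, so only finitely many of its terms can vanish.
inv : ℚ → ℚ
inv p with p ℚ.≟ 0ℚ
... | yes _  = 0ℚ
... | no p≢0 = (ℚ.1/ p) {{ℚ.≢-nonZero p≢0}}

greatest : {P : ℕ → Set} → U.Decidable P → ℕ → ℕ
greatest P? zero    = zero
greatest P? (suc n) with P? (suc n)
... | yes _ = suc n
... | no  _ = greatest P? n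

module RationalLemmas where
  open import Data.Rational.Base
  open ℚ.≤-Reasoning

  <⇒≱ : ∀ {p q} → p < q → ¬ (q ≤ p)
  <⇒≱ p<q q≤p = ℚ.<-irrefl refl (ℚ.<-≤-trans p<q q≤p)

  *-mono-nonNeg : ∀ {a b c d} → 0ℚ ≤ b → 0ℚ ≤ c → a ≤ b → c ≤ d → a * c ≤ b * d
  *-mono-nonNeg {a} {b} {c} {d} 0≤b 0≤c a≤b c≤d = begin
    a * c ≤⟨ ℚ.*-monoʳ-≤-nonNeg c {{nonNegative 0≤c}} a≤b ⟩
    b * c ≤⟨ ℚ.*-monoˡ-≤-nonNeg b {{nonNegative 0≤b}} c≤d ⟩
    b * d ∎

  *-monoʳ : ∀ {a b} c → 0ℚ ≤ c → a ≤ b → a * c ≤ b * c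
  *-monoʳ c 0≤c = ℚ.*-monoʳ-≤-nonNeg c {{nonNegative 0≤c}}

  *-monoˡ : ∀ {a b} c → 0ℚ ≤ c → a ≤ b → c * a ≤ c * b
  *-monoˡ c 0≤c = ℚ.*-monoˡ-≤-nonNeg c {{nonNegative 0≤c}}

  0≤* : ∀ {a b} → 0ℚ ≤ a → 0ℚ ≤ b → 0ℚ ≤ a * b
  0≤* {a} {b} 0≤a 0≤b = begin
    0ℚ     ≡⟨ ℚ.*-zeroˡ b ⟨
    0ℚ * b ≤⟨ *-monoʳ b 0≤b 0≤a ⟩
    a * b  ∎

  0<* : ∀ {a b} → 0ℚ < a → 0ℚ < b → 0ℚ < a * b
  0<* {a} {b} 0<a 0<b = begin-strict
    0ℚ     ≡⟨ ℚ.*-zeroˡ b ⟨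
    0ℚ * b <⟨ ℚ.*-monoˡ-<-pos b {{positive 0<b}} 0<a ⟩
    a * b  ∎

  0<½* : ∀ {a} → 0ℚ < a → 0ℚ < ½ * a
  0<½* = 0<* (ℚ.positive⁻¹ ½)

  ½+½ : ∀ a → ½ * a + ½ * a ≡ a
  ½+½ a = trans (sym (ℚ.*-distribʳ-+ a ½ ½)) (ℚ.*-identityˡ a)

  p≤q+p : ∀ {p q} → 0ℚ ≤ q → p ≤ q + p
  p≤q+p {p} {q} 0≤q = begin
    p      ≡⟨ ℚ.+-identityˡ p ⟨
    0ℚ + p ≤⟨ ℚ.+-monoˡ-≤ p 0≤q ⟩
    q + p  ∎

  p≤∣p∣ : ∀ p → p ≤ ∣ p ∣
  p≤∣p∣ p with ℚ.≤-total 0ℚ p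
  ... | inj₁ 0≤p = ℚ.≤-reflexive (sym (ℚ.0≤p⇒∣p∣≡p 0≤p))
  ... | inj₂ p≤0 = ℚ.≤-trans p≤0 (ℚ.0≤∣p∣ p)

  flip-minus : ∀ p q → - (p - q) ≡ q - p
  flip-minus = solve 2 (λ p q → :- (p :- q) := q :- p) refl
    where open +-*-Solver

  ∣p-q∣-comm : ∀ p q → ∣ p - q ∣ ≡ ∣ q - p ∣
  ∣p-q∣-comm p q = trans (sym (ℚ.∣-p∣≡∣p∣ (p - q))) (cong ∣_∣ (flip-minus p q))

  minus-plus : ∀ p q → (p - q) + q ≡ p
  minus-plus = solve 2 (λ p q → (p :- q) :+ q := p) refl
    where open +-*-Solver

  plus-minus : ∀ p q → (p + q) - p ≡ q
  plus-minus = solve 2 (λ p q → (p :+ q) :- p := q) refl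
    where open +-*-Solver

  ∣-∣≤⇒≤ : ∀ {p q e} → ∣ p - q ∣ ≤ e → p ≤ q + e
  ∣-∣≤⇒≤ {p} {q} {e} h = begin
    p           ≡⟨ minus-plus p q ⟨
    (p - q) + q ≤⟨ ℚ.+-monoˡ-≤ q (ℚ.≤-trans (p≤∣p∣ (p - q)) h) ⟩
    e + q       ≡⟨ ℚ.+-comm e q ⟩
    q + e       ∎

  ≤⇒minus≤ : ∀ {p q e} → p ≤ q + e → p - q ≤ e
  ≤⇒minus≤ {p} {q} {e} h = begin
    p - q       ≤⟨ ℚ.+-monoˡ-≤ (- q) h ⟩
    (q + e) - q ≡⟨ plus-minus q e ⟩
    e           ∎

  ≤⇒∣-∣≤ : ∀ {p q e} → p ≤ q + e → q ≤ p + e → ∣ p - q ∣ ≤ e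
  ≤⇒∣-∣≤ {p} {q} {e} h₁ h₂ with ℚ.∣p∣≡p∨∣p∣≡-p (p - q)
  ... | inj₁ eq = subst (_≤ e) (sym eq) (≤⇒minus≤ h₁)
  ... | inj₂ eq = subst (_≤ e) (sym (trans eq (flip-minus p q))) (≤⇒minus≤ h₂)

  /-split : ∀ i j k → + (i ℕ.+ j) / suc k ≡ (+ i / suc k) + (+ j / suc k)
  /-split i j k = ℚ.toℚᵘ-injective (ℚᵘ.≃-trans (ℚ.toℚᵘ-fromℚᵘ (mkℚᵘ (+ (i ℕ.+ j)) k))
    (ℚᵘ.≃-sym (ℚᵘ.≃-trans (ℚ.toℚᵘ-homo-+ (+ i / suc k) (+ j / suc k))
      (ℚᵘ.≃-trans (ℚᵘ.+-cong (ℚ.toℚᵘ-fromℚᵘ (mkℚᵘ (+ i) k)) (ℚ.toℚᵘ-fromℚᵘ (mkℚᵘ (+ j) k)))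
        (ℚᵘ.*≡* eq)))))
    where
    s = + suc k
    eq : ((+ i) ℤ.* s ℤ.+ (+ j) ℤ.* s) ℤ.* s ≡ (+ (i ℕ.+ j)) ℤ.* + (suc k ℕ.* suc k)
    eq = trans (cong (ℤ._* s) (sym (ℤ.*-distribʳ-+ s (+ i) (+ j))))
      (trans (ℤ.*-assoc (+ (i ℕ.+ j)) s s) (cong ((+ (i ℕ.+ j)) ℤ.*_) (sym (ℤ.pos-* (suc k) (suc k)))))

  fromℕℚ-suc : ∀ n → fromℕℚ (suc n) ≡ 1ℚ + fromℕℚ n
  fromℕℚ-suc n = /-split 1 n 0

  /-mono : ∀ {i j} k → i ℕ.≤ j → + i / suc k ≤ + j / suc k
  /-mono {i} {j} k i≤j = ℚ.toℚᵘ-cancel-≤ (ℚᵘ.≤-respˡ-≃ (ℚᵘ.≃-sym (ℚ.toℚᵘ-fromℚᵘ (mkℚᵘ (+ i) k)))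
    (ℚᵘ.≤-respʳ-≃ (ℚᵘ.≃-sym (ℚ.toℚᵘ-fromℚᵘ (mkℚᵘ (+ j) k)))
      (ℚᵘ.*≤* (ℤ.*-monoʳ-≤-nonNeg (+ suc k) (ℤ.+≤+ i≤j)))))

  0≤/ : ∀ i k → 0ℚ ≤ + i / suc k
  0≤/ i k = ℚ.nonNegative⁻¹ _ {{ℚ.normalize-nonNeg i (suc k)}}

  0<1/ : ∀ k → 0ℚ < + 1 / suc k
  0<1/ k = ℚ.positive⁻¹ _ {{ℚ.normalize-pos 1 (suc k)}}

  1≤fromℕℚ : ∀ n → 1ℚ ≤ fromℕℚ (suc n)
  1≤fromℕℚ n = /-mono {1} {suc n} 0 (ℕ.s≤s ℕ.z≤n)

  fromℕℚ-+ : ∀ m n → fromℕℚ (m ℕ.+ n) ≡ fromℕℚ m + fromℕℚ n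
  fromℕℚ-+ m n = /-split m n 0

  fromℕℚ-* : ∀ m n → fromℕℚ (m ℕ.* n) ≡ fromℕℚ m * fromℕℚ n
  fromℕℚ-* zero    n = sym (ℚ.*-zeroˡ (fromℕℚ n))
  fromℕℚ-* (suc m) n = begin-equality
    fromℕℚ (n ℕ.+ m ℕ.* n)                  ≡⟨ fromℕℚ-+ n (m ℕ.* n) ⟩
    fromℕℚ n + fromℕℚ (m ℕ.* n)             ≡⟨ cong (λ w → fromℕℚ n + w) (fromℕℚ-* m n) ⟩
    fromℕℚ n + fromℕℚ m * fromℕℚ n          ≡⟨ cong (_+ fromℕℚ m * fromℕℚ n) (ℚ.*-identityˡ (fromℕℚ n)) ⟨
    1ℚ * fromℕℚ n + fromℕℚ m * fromℕℚ n     ≡⟨ ℚ.*-distribʳ-+ (fromℕℚ n) 1ℚ (fromℕℚ m) ⟨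
    (1ℚ + fromℕℚ m) * fromℕℚ n              ≡⟨ cong (_* fromℕℚ n) (fromℕℚ-suc m) ⟨
    fromℕℚ (suc m) * fromℕℚ n               ∎

  fromℕℚ-^ : ∀ m k → fromℕℚ (m ℕ.^ k) ≡ fromℕℚ m ^ℚ k
  fromℕℚ-^ m zero    = refl
  fromℕℚ-^ m (suc k) = trans (fromℕℚ-* m (m ℕ.^ k)) (cong (fromℕℚ m *_) (fromℕℚ-^ m k))

  /-scale : ∀ i k → (+ i / suc k) * fromℕℚ (suc k) ≡ fromℕℚ i
  /-scale i k = ℚ.toℚᵘ-injective (ℚᵘ.≃-trans (ℚ.toℚᵘ-homo-* (+ i / suc k) (fromℕℚ (suc k)))
    (ℚᵘ.≃-trans (ℚᵘ.*-cong (ℚ.toℚᵘ-fromℚᵘ (mkℚᵘ (+ i) k)) (ℚ.toℚᵘ-fromℚᵘ (mkℚᵘ (+ suc k) 0)))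
      (ℚᵘ.≃-trans (ℚᵘ.*≡* eq) (ℚᵘ.≃-sym (ℚ.toℚᵘ-fromℚᵘ (mkℚᵘ (+ i) 0))))))
    where
    eq : ((+ i) ℤ.* + suc k) ℤ.* + 1 ≡ + i ℤ.* + (suc k ℕ.* 1)
    eq = trans (ℤ.*-assoc (+ i) (+ suc k) (+ 1)) (cong (+ i ℤ.*_) (sym (ℤ.pos-* (suc k) 1)))

  1/-anti : ∀ {k l} → k ℕ.≤ l → + 1 / suc l ≤ + 1 / suc k
  1/-anti {k} {l} k≤l = ℚ.toℚᵘ-cancel-≤ (ℚᵘ.≤-respˡ-≃ (ℚᵘ.≃-sym (ℚ.toℚᵘ-fromℚᵘ (mkℚᵘ (+ 1) l)))
    (ℚᵘ.≤-respʳ-≃ (ℚᵘ.≃-sym (ℚ.toℚᵘ-fromℚᵘ (mkℚᵘ (+ 1) k)))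
      (ℚᵘ.*≤* (ℤ.*-monoˡ-≤-nonNeg (+ 1) (ℤ.+≤+ (ℕ.s≤s k≤l))))))

  archimedean : ∀ x → ∃[ k ] x ≤ fromℕℚ (suc k)
  archimedean x@(mkℚ (+ n) d _) = n , ℚ.toℚᵘ-cancel-≤
    (ℚᵘ.≤-respʳ-≃ (ℚᵘ.≃-sym (ℚ.toℚᵘ-fromℚᵘ (mkℚᵘ (+ suc n) 0)))
      (ℚᵘ.*≤* (subst₂ ℤ._≤_ (ℤ.pos-* n 1) (ℤ.pos-* (suc n) (suc d))
        (ℤ.+≤+ (ℕ.*-mono-≤ (ℕ.n≤1+n n) (ℕ.s≤s (ℕ.z≤n {d})))))))
  archimedean x@(mkℚ -[1+ n ] d _) = 0 , ℚ.≤-trans (ℚ.<⇒≤ (ℚ.negative⁻¹ x)) (0≤/ 1 0)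

  shrink : ∀ A {e} → 0ℚ < e → ∃[ d ] (0ℚ < d × d * A ≤ e)
  shrink A {e} 0<e = let k , A≤ = archimedean A in
    e * (+ 1 / suc k) , 0<* 0<e (0<1/ k) , (begin
    e * (+ 1 / suc k) * A                 ≤⟨ *-monoˡ _ (ℚ.<⇒≤ (0<* 0<e (0<1/ k))) A≤ ⟩
    e * (+ 1 / suc k) * fromℕℚ (suc k)    ≡⟨ ℚ.*-assoc e _ _ ⟩
    e * ((+ 1 / suc k) * fromℕℚ (suc k))  ≡⟨ cong (e *_) (/-scale 1 k) ⟩
    e * 1ℚ                                ≡⟨ ℚ.*-identityʳ e ⟩
    e                                     ∎)

  module _ {e} (0<e : 0ℚ < e) where
    private instance
      e-pos : Positive e
      e-pos = positive 0<e
      e≢0 : NonZero e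
      e≢0 = ℚ.pos⇒nonZero e

    grow : ∀ A → ∃[ k ] A ≤ fromℕℚ (suc k) * e
    grow A = let k , h = archimedean (A * 1/ e) in k , (begin
      A                    ≡⟨ ℚ.*-identityʳ A ⟨
      A * 1ℚ               ≡⟨ cong (A *_) (ℚ.*-inverseˡ e) ⟨
      A * (1/ e * e)       ≡⟨ ℚ.*-assoc A _ _ ⟨
      A * 1/ e * e         ≤⟨ *-monoʳ e (ℚ.<⇒≤ 0<e) h ⟩
      fromℕℚ (suc k) * e   ∎)

  reciprocal-bound : ∀ {e u K} → 0ℚ ≤ u → u * K ≡ 1ℚ → 1ℚ ≤ K * e → u ≤ e
  reciprocal-bound {e} {u} {K} 0≤u uK≡1 h = begin
    u             ≡⟨ ℚ.*-identityˡ u ⟨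
    1ℚ * u        ≤⟨ *-monoʳ u 0≤u h ⟩
    K * e * u     ≡⟨ rearrange K e u ⟩
    (u * K) * e   ≡⟨ cong (_* e) uK≡1 ⟩
    1ℚ * e        ≡⟨ ℚ.*-identityˡ e ⟩
    e             ∎
    where
    open +-*-Solver
    rearrange : ∀ a b c → a * b * c ≡ (c * a) * b
    rearrange = solve 3 (λ a b c → a :* b :* c := (c :* a) :* b) refl

  /-inverse : ∀ k → (+ 1 / suc k) * fromℕℚ (suc k) ≡ 1ℚ
  /-inverse = /-scale 1

  small : ∀ {e} → 0ℚ < e → ∃[ k ] + 1 / suc k ≤ e
  small {e} 0<e = let k , h = grow 0<e 1ℚ in
    k , reciprocal-bound {e} {+ 1 / suc k} {fromℕℚ (suc k)} (0≤/ 1 k) (/-inverse k) h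

  ^-nonNeg : ∀ {x} k → 0ℚ ≤ x → 0ℚ ≤ x ^ℚ k
  ^-nonNeg zero    0≤x = 0≤/ 1 0
  ^-nonNeg (suc k) 0≤x = 0≤* 0≤x (^-nonNeg k 0≤x)

  ^-pos : ∀ {x} k → 0ℚ < x → 0ℚ < x ^ℚ k
  ^-pos zero    0<x = 0<1/ 0
  ^-pos (suc k) 0<x = 0<* 0<x (^-pos k 0<x)

  ^-mono : ∀ {x y} k → 0ℚ ≤ x → x ≤ y → x ^ℚ k ≤ y ^ℚ k
  ^-mono zero    0≤x x≤y = ℚ.≤-refl
  ^-mono (suc k) 0≤x x≤y = *-mono-nonNeg (ℚ.≤-trans 0≤x x≤y) (^-nonNeg k 0≤x) x≤y (^-mono k 0≤x x≤y)

  ^-mono-< : ∀ {x y} k → 0ℚ ≤ x → x < y → x ^ℚ suc k < y ^ℚ suc k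
  ^-mono-< {x} {y} k 0≤x x<y = begin-strict
    x * x ^ℚ k ≤⟨ *-monoˡ x 0≤x (^-mono k 0≤x (ℚ.<⇒≤ x<y)) ⟩
    x * y ^ℚ k <⟨ ℚ.*-monoˡ-<-pos (y ^ℚ k) {{positive (^-pos k (ℚ.≤-<-trans 0≤x x<y))}} x<y ⟩
    y * y ^ℚ k ∎

  ^-cancel-≤ : ∀ {x y} k → 0ℚ ≤ y → x ^ℚ suc k ≤ y ^ℚ suc k → x ≤ y
  ^-cancel-≤ {x} {y} k 0≤y h with x ℚ.≤? y
  ... | yes x≤y = x≤y
  ... | no  x≰y = ⊥-elim (ℚ.<-irrefl refl (ℚ.<-≤-trans (^-mono-< k 0≤y (ℚ.≰⇒> x≰y)) h))

  ^-cancel-< : ∀ {x y} k → 0ℚ ≤ y → x ^ℚ k < y ^ℚ k → x < y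
  ^-cancel-< {x} {y} k 0≤y h with x ℚ.<? y
  ... | yes x<y = x<y
  ... | no  x≮y = ⊥-elim (ℚ.<-irrefl refl (ℚ.<-≤-trans h (^-mono k 0≤y (ℚ.≮⇒≥ x≮y))))

  1≤^ : ∀ {x} k → 1ℚ ≤ x → 1ℚ ≤ x ^ℚ k
  1≤^ zero    1≤x = ℚ.≤-refl
  1≤^ (suc k) 1≤x = *-mono-nonNeg (ℚ.≤-trans (0≤/ 1 0) 1≤x) (0≤/ 1 0) 1≤x (1≤^ k 1≤x)

  x≤x^ : ∀ {x} k → 1ℚ ≤ x → x ≤ x ^ℚ suc k
  x≤x^ {x} k 1≤x = subst (_≤ x * x ^ℚ k) (ℚ.*-identityʳ x)
    (*-monoˡ x (ℚ.≤-trans (0≤/ 1 0) 1≤x) (1≤^ k 1≤x))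

  bernoulli : ∀ {e} k → 0ℚ ≤ e → 1ℚ + fromℕℚ k * e ≤ (1ℚ + e) ^ℚ k
  bernoulli {e} zero    0≤e = ℚ.≤-reflexive (trans (cong (λ w → 1ℚ + w) (ℚ.*-zeroˡ e)) (ℚ.+-identityʳ 1ℚ))
  bernoulli {e} (suc k) 0≤e = begin
    1ℚ + fromℕℚ (suc k) * e                          ≡⟨ cong (λ z → 1ℚ + z * e) (fromℕℚ-suc k) ⟩
    1ℚ + (1ℚ + K) * e                                ≤⟨ p≤q+p (0≤* (0≤* (0≤/ k 0) 0≤e) 0≤e) ⟩
    K * e * e + (1ℚ + (1ℚ + K) * e)                  ≡⟨ expand e K ⟩
    (1ℚ + e) * (1ℚ + K * e)                          ≤⟨ *-monoˡ (1ℚ + e) 0≤1+e (bernoulli k 0≤e) ⟩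
    (1ℚ + e) * (1ℚ + e) ^ℚ k                         ∎
    where
    K = fromℕℚ k
    0≤1+e : 0ℚ ≤ 1ℚ + e
    0≤1+e = ℚ.+-mono-≤ (0≤/ 1 0) 0≤e
    open +-*-Solver
    expand : ∀ e K → K * e * e + (1ℚ + (1ℚ + K) * e) ≡ (1ℚ + e) * (1ℚ + K * e)
    expand = solve 2 (λ e K → K :* e :* e :+ (con 1ℚ :+ (con 1ℚ :+ K) :* e)
                            := (con 1ℚ :+ e) :* (con 1ℚ :+ K :* e)) refl

  inv-inverse : ∀ {p} → 0ℚ < p → inv p * p ≡ 1ℚ
  inv-inverse {p} 0<p with p ℚ.≟ 0ℚ
  ... | yes p≡0 = ⊥-elim (ℚ.<-irrefl (sym p≡0) 0<p)
  ... | no  p≢0 = ℚ.*-inverseˡ p {{≢-nonZero p≢0}}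

  inv-pos : ∀ {p} → 0ℚ < p → 0ℚ < inv p
  inv-pos {p} 0<p with p ℚ.≟ 0ℚ
  ... | yes p≡0 = ⊥-elim (ℚ.<-irrefl (sym p≡0) 0<p)
  ... | no  p≢0 = ℚ.positive⁻¹ _ {{ℚ.1/pos⇒pos p {{positive 0<p}}}}

  inv-anti : ∀ {p q} → 0ℚ < p → p ≤ q → inv q ≤ inv p
  inv-anti {p} {q} 0<p p≤q = begin
    inv q                 ≡⟨ ℚ.*-identityʳ (inv q) ⟨
    inv q * 1ℚ            ≡⟨ cong (inv q *_) (inv-inverse 0<p) ⟨
    inv q * (inv p * p)   ≤⟨ *-monoˡ (inv q) (ℚ.<⇒≤ (inv-pos 0<q)) (*-monoˡ (inv p) (ℚ.<⇒≤ (inv-pos 0<p)) p≤q) ⟩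
    inv q * (inv p * q)   ≡⟨ rearrange (inv q) (inv p) q ⟩
    inv p * (inv q * q)   ≡⟨ cong (inv p *_) (inv-inverse 0<q) ⟩
    inv p * 1ℚ            ≡⟨ ℚ.*-identityʳ (inv p) ⟩
    inv p                 ∎
    where
    0<q = ℚ.<-≤-trans 0<p p≤q
    open +-*-Solver
    rearrange : ∀ a b c → a * (b * c) ≡ b * (a * c)
    rearrange = solve 3 (λ a b c → a :* (b :* c) := b :* (a :* c)) refl

  module IntegerPower (b : ℚ) (1≤b : 1ℚ ≤ b) where
    instance
      b-pos : Positive b
      b-pos = positive (ℚ.<-≤-trans (0<1/ 0) 1≤b)
      b≢0 : NonZero b
      b≢0 = ℚ.pos⇒nonZero b

    0<b : 0ℚ < b
    0<b = ℚ.positive⁻¹ b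

    ^ᶻ-pos : ∀ z → 0ℚ < b ^ᶻ z
    ^ᶻ-pos (+ k)    = ^-pos k 0<b
    ^ᶻ-pos -[1+ k ] = ^-pos (suc k) (ℚ.positive⁻¹ (1/ b) {{ℚ.1/pos⇒pos b}})

    ^ᶻ-suc : ∀ z → b ^ᶻ (+ 1 ℤ.+ z) ≡ b * b ^ᶻ z
    ^ᶻ-suc (+ k)        = refl
    ^ᶻ-suc -[1+ zero ]  = sym (trans (cong (b *_) (ℚ.*-identityʳ (1/ b))) (ℚ.*-inverseʳ b))
    ^ᶻ-suc -[1+ suc k ] = sym (trans (sym (ℚ.*-assoc b (1/ b) _))
      (trans (cong (_* (1/ b) ^ℚ suc k) (ℚ.*-inverseʳ b)) (ℚ.*-identityˡ _)))

    ^ᶻ-plus : ∀ k z → b ^ᶻ (+ k ℤ.+ z) ≡ b ^ℚ k * b ^ᶻ z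
    ^ᶻ-plus zero    z = trans (cong (b ^ᶻ_) (ℤ.+-identityˡ z)) (sym (ℚ.*-identityˡ _))
    ^ᶻ-plus (suc k) z = begin-equality
      b ^ᶻ (+ suc k ℤ.+ z)           ≡⟨ cong (b ^ᶻ_) (ℤ.+-assoc (+ 1) (+ k) z) ⟩
      b ^ᶻ (+ 1 ℤ.+ (+ k ℤ.+ z))     ≡⟨ ^ᶻ-suc (+ k ℤ.+ z) ⟩
      b * b ^ᶻ (+ k ℤ.+ z)           ≡⟨ cong (b *_) (^ᶻ-plus k z) ⟩
      b * (b ^ℚ k * b ^ᶻ z)          ≡⟨ ℚ.*-assoc b _ _ ⟨
      b * b ^ℚ k * b ^ᶻ z            ∎

    ^ᶻ-^ : ∀ z k → (b ^ᶻ z) ^ℚ k ≡ b ^ᶻ (z ℤ.* + k)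
    ^ᶻ-^ (+ n)    k       = trans (^ℚ-assocʳ b n k) (cong (b ^ᶻ_) (ℤ.pos-* n k))
    ^ᶻ-^ -[1+ n ] zero    = cong (b ^ᶻ_) (sym (ℤ.*-zeroʳ -[1+ n ]))
    ^ᶻ-^ -[1+ n ] (suc k) = ^ℚ-assocʳ (1/ b) (suc n) (suc k)

    ^ᶻ-mono : ∀ {y z} → y ℤ.≤ z → b ^ᶻ y ≤ b ^ᶻ z
    ^ᶻ-mono {y} {z} y≤z = begin
      b ^ᶻ y                       ≡⟨ ℚ.*-identityˡ _ ⟨
      1ℚ * b ^ᶻ y                  ≤⟨ *-monoʳ (b ^ᶻ y) (ℚ.<⇒≤ (^ᶻ-pos y)) (1≤^ k 1≤b) ⟩
      b ^ℚ k * b ^ᶻ y              ≡⟨ ^ᶻ-plus k y ⟨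
      b ^ᶻ (+ k ℤ.+ y)             ≡⟨ cong (λ w → b ^ᶻ (w ℤ.+ y)) (ℤ.0≤i⇒+∣i∣≡i (ℤ.i≤j⇒0≤j-i y≤z)) ⟩
      b ^ᶻ ((z ℤ.- y) ℤ.+ y)       ≡⟨ cong (b ^ᶻ_) (ℤ.+-assoc z (ℤ.- y) y) ⟩
      b ^ᶻ (z ℤ.+ (ℤ.- y ℤ.+ y))   ≡⟨ cong (λ w → b ^ᶻ (z ℤ.+ w)) (ℤ.+-inverseˡ y) ⟩
      b ^ᶻ (z ℤ.+ + 0)             ≡⟨ cong (b ^ᶻ_) (ℤ.+-identityʳ z) ⟩
      b ^ᶻ z                       ∎
      where k = ℤ.∣ z ℤ.- y ∣

  greatest-holds : ∀ {P : ℕ → Set} (P? : U.Decidable P) n → P 0 → P (greatest P? n)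
  greatest-holds P? zero    p0 = p0
  greatest-holds P? (suc n) p0 with P? (suc n)
  ... | yes p = p
  ... | no  _ = greatest-holds P? n p0

  greatest-maximal : ∀ {P : ℕ → Set} (P? : U.Decidable P) n →
                     ¬ P (suc n) → ¬ P (suc (greatest P? n))
  greatest-maximal P? zero    ¬p = ¬p
  greatest-maximal P? (suc n) ¬p with P? (suc n)
  ... | yes _ = ¬p
  ... | no ¬q = greatest-maximal P? n ¬q

open RationalLemmas

-- For rational a = p/q, powerFloor n a k is (n+1)^a rounded down to a multiple
-- of 1/(k+1), i.e. the largest i/(k+1) such that (i/(k+1))^q ≤ (n+1)^p.
module _ (n : ℕ) where

  base : ℚ
  base = fromℕℚ (suc n)

  open IntegerPower base (1≤fromℕℚ n)

  BelowPower : ℚ → ℕ → ℕ → Set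
  BelowPower a k i = (+ i ℚ./ suc k) ^ℚ ↧ₙ a ℚ.≤ base ^ᶻ ↥ a

  belowPower? : ∀ a k → U.Decidable (BelowPower a k)
  belowPower? a k i = (+ i ℚ./ suc k) ^ℚ ↧ₙ a ℚ.≤? base ^ᶻ ↥ a

  -- The search bound is (n+1)^|p|, which is at least (n+1)^(p/q).
  powerFloor : ℚ → ℕ → ℚ
  powerFloor a k =
    + greatest (belowPower? a k) (suc k ℕ.* suc n ℕ.^ ℤ.∣ ↥ a ∣) ℚ./ suc k

  module PowerFloorLemmas where
    open import Data.Rational.Base
    open ℚ.≤-Reasoning

    powerFloor-nonNeg : ∀ a k → 0ℚ ≤ powerFloor a k
    powerFloor-nonNeg a k = 0≤/ (greatest (belowPower? a k) (suc k ℕ.* suc n ℕ.^ ℤ.∣ ↥ a ∣)) k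

    i≤∣i∣ : ∀ i → i ℤ.≤ + ℤ.∣ i ∣
    i≤∣i∣ (+ i)    = ℤ.≤-refl
    i≤∣i∣ -[1+ i ] = ℤ.-≤+

    powerFloor-lower : ∀ a k → powerFloor a k ^ℚ ↧ₙ a ≤ base ^ᶻ ↥ a
    powerFloor-lower a k = greatest-holds (belowPower? a k) (suc k ℕ.* suc n ℕ.^ ℤ.∣ ↥ a ∣) (begin
      (+ 0 / suc k) ^ℚ ↧ₙ a  ≡⟨ cong (_^ℚ ↧ₙ a) (ℚ.0/n≡0 (suc k)) ⟩
      0ℚ ^ℚ ↧ₙ a             ≡⟨ ℚ.*-zeroˡ (0ℚ ^ℚ ℚ.denominator-1 a) ⟩
      0ℚ                     <⟨ ^ᶻ-pos (↥ a) ⟩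
      base ^ᶻ ↥ a            ∎)

    bound : ∀ k c → base ^ℚ c ≤ + (suc k ℕ.* suc n ℕ.^ c) / suc k
    bound k c = ℚ.*-cancelʳ-≤-pos (fromℕℚ (suc k)) {{positive (ℚ.<-≤-trans (0<1/ 0) (1≤fromℕℚ k))}} (begin
      base ^ℚ c * fromℕℚ (suc k)                              ≡⟨ ℚ.*-comm (base ^ℚ c) _ ⟩
      fromℕℚ (suc k) * base ^ℚ c                              ≡⟨ cong (fromℕℚ (suc k) *_) (fromℕℚ-^ (suc n) c) ⟨
      fromℕℚ (suc k) * fromℕℚ (suc n ℕ.^ c)                   ≡⟨ fromℕℚ-* (suc k) (suc n ℕ.^ c) ⟨
      fromℕℚ (suc k ℕ.* suc n ℕ.^ c)                          ≡⟨ /-scale (suc k ℕ.* suc n ℕ.^ c) k ⟨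
      (+ (suc k ℕ.* suc n ℕ.^ c) / suc k) * fromℕℚ (suc k)    ∎)

    powerFloor-upper : ∀ a k → base ^ᶻ ↥ a < (powerFloor a k + (+ 1 / suc k)) ^ℚ ↧ₙ a
    powerFloor-upper a k = subst (λ w → base ^ᶻ ↥ a < w ^ℚ ↧ₙ a)
        (trans (/-split 1 i k) (ℚ.+-comm (+ 1 / suc k) (powerFloor a k)))
        (ℚ.≰⇒> (greatest-maximal (belowPower? a k) B (<⇒≱ (begin-strict
          base ^ᶻ ↥ a                          ≤⟨ ^ᶻ-mono (i≤∣i∣ (↥ a)) ⟩
          base ^ℚ c                            ≤⟨ x≤x^ (ℚ.denominator-1 a) (1≤^ c (1≤fromℕℚ n)) ⟩
          (base ^ℚ c) ^ℚ ↧ₙ a                  <⟨ ^-mono-< (ℚ.denominator-1 a) (^-nonNeg c (ℚ.<⇒≤ 0<b)) above ⟩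
          (+ suc B / suc k) ^ℚ ↧ₙ a            ∎))))
      where
      c = ℤ.∣ ↥ a ∣
      B = suc k ℕ.* suc n ℕ.^ c
      i = greatest (belowPower? a k) B
      above : base ^ℚ c < + suc B / suc k
      above = begin-strict
        base ^ℚ c                          ≤⟨ bound k c ⟩
        + B / suc k                        ≡⟨ ℚ.+-identityˡ _ ⟨
        0ℚ + (+ B / suc k)                 <⟨ ℚ.+-monoˡ-< (+ B / suc k) (0<1/ k) ⟩
        (+ 1 / suc k) + (+ B / suc k)      ≡⟨ /-split 1 B k ⟨
        + suc B / suc k                    ∎

    cross : ∀ a a′ K → a ≤ a′ + (+ 1 / suc K) →
            ↥ a ℤ.* + (↧ₙ a′ ℕ.* suc K) ℤ.≤ + (↧ₙ a′ ℕ.* ↧ₙ a) ℤ.+ ↥ a′ ℤ.* + (suc K ℕ.* ↧ₙ a)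
    cross a@(mkℚ p d _) a′@(mkℚ p′ d′ _) K h = subst (p ℤ.* + (suc d′ ℕ.* suc K) ℤ.≤_) eq
      (ℚᵘ.drop-*≤* (ℚᵘ.≤-respʳ-≃ (ℚᵘ.≃-trans (ℚ.toℚᵘ-homo-+ a′ (+ 1 / suc K))
        (ℚᵘ.+-cong {toℚᵘ a′} ℚᵘ.≃-refl (ℚ.toℚᵘ-fromℚᵘ (mkℚᵘ (+ 1) K)))) (ℚ.toℚᵘ-mono-≤ h)))
      where
      q = + suc d
      q′ = + suc d′
      s = + suc K
      open ℤSolver.+-*-Solver
      eq : (p′ ℤ.* s ℤ.+ + 1 ℤ.* q′) ℤ.* q ≡ + (suc d′ ℕ.* suc d) ℤ.+ p′ ℤ.* + (suc K ℕ.* suc d)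
      eq = trans (solve 4 (λ p′ s q′ q → (p′ :* s :+ con (+ 1) :* q′) :* q
                                      := q′ :* q :+ p′ :* (s :* q)) refl p′ s q′ q)
        (cong₂ (λ u v → u ℤ.+ p′ ℤ.* v) (sym (ℤ.pos-* (suc d′) (suc d))) (sym (ℤ.pos-* (suc K) (suc d))))

    -- If r ≤ bᵃ, bᵃ′ ≤ s and a ≤ a′ + 1/(K+1), then r ≤ b^(1/(K+1)) s.
    compare : ∀ a a′ K {r s} → 0ℚ ≤ r → 0ℚ ≤ s → a ≤ a′ + (+ 1 / suc K) →
              r ^ℚ ↧ₙ a ≤ base ^ᶻ ↥ a → base ^ᶻ ↥ a′ ≤ s ^ℚ ↧ₙ a′ →
              r ^ℚ suc K ≤ base * s ^ℚ suc K
    compare a a′ K {r} {s} 0≤r 0≤s h r≤ ≤s = ^-cancel-≤ (ℕ.pred (q′ ℕ.* q)) (0≤* (ℚ.<⇒≤ 0<b) (^-nonNeg (suc K) 0≤s)) (begin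
      (r ^ℚ k) ^ℚ (q′ ℕ.* q)                             ≡⟨ ^ℚ-assocʳ r k (q′ ℕ.* q) ⟩
      r ^ℚ (k ℕ.* (q′ ℕ.* q))                            ≡⟨ cong (r ^ℚ_) (swap₁ k q′ q) ⟩
      r ^ℚ (q ℕ.* (q′ ℕ.* k))                            ≡⟨ ^ℚ-assocʳ r q (q′ ℕ.* k) ⟨
      (r ^ℚ q) ^ℚ (q′ ℕ.* k)                             ≤⟨ ^-mono (q′ ℕ.* k) (^-nonNeg q 0≤r) r≤ ⟩
      (base ^ᶻ ↥ a) ^ℚ (q′ ℕ.* k)                        ≡⟨ ^ᶻ-^ (↥ a) (q′ ℕ.* k) ⟩
      base ^ᶻ (↥ a ℤ.* + (q′ ℕ.* k))                     ≤⟨ ^ᶻ-mono (cross a a′ K h) ⟩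
      base ^ᶻ (+ (q′ ℕ.* q) ℤ.+ ↥ a′ ℤ.* + (k ℕ.* q))    ≡⟨ ^ᶻ-plus (q′ ℕ.* q) (↥ a′ ℤ.* + (k ℕ.* q)) ⟩
      B * base ^ᶻ (↥ a′ ℤ.* + (k ℕ.* q))                 ≡⟨ cong (B *_) (^ᶻ-^ (↥ a′) (k ℕ.* q)) ⟨
      B * (base ^ᶻ ↥ a′) ^ℚ (k ℕ.* q)                    ≤⟨ *-monoˡ B (^-nonNeg (q′ ℕ.* q) (ℚ.<⇒≤ 0<b))
                                                            (^-mono (k ℕ.* q) (ℚ.<⇒≤ (^ᶻ-pos (↥ a′))) ≤s) ⟩
      B * (s ^ℚ q′) ^ℚ (k ℕ.* q)                         ≡⟨ cong (B *_) (^ℚ-assocʳ s q′ (k ℕ.* q)) ⟩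
      B * s ^ℚ (q′ ℕ.* (k ℕ.* q))                        ≡⟨ cong (λ w → B * s ^ℚ w) (swap₂ k q′ q) ⟩
      B * s ^ℚ (k ℕ.* (q′ ℕ.* q))                        ≡⟨ cong (B *_) (^ℚ-assocʳ s k (q′ ℕ.* q)) ⟨
      B * (s ^ℚ k) ^ℚ (q′ ℕ.* q)                         ≡⟨ ^ℚ-distrib-* base (s ^ℚ k) (q′ ℕ.* q) ⟨
      (base * s ^ℚ k) ^ℚ (q′ ℕ.* q)                      ∎)
      where
      k = suc K
      q = ↧ₙ a
      q′ = ↧ₙ a′
      B = base ^ℚ (q′ ℕ.* q)
      open ℕSolver.+-*-Solver
      swap₁ : ∀ k q′ q → k ℕ.* (q′ ℕ.* q) ≡ q ℕ.* (q′ ℕ.* k)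
      swap₁ = solve 3 (λ k q′ q → k :* (q′ :* q) := q :* (q′ :* k)) refl
      swap₂ : ∀ k q′ q → q′ ℕ.* (k ℕ.* q) ≡ k ℕ.* (q′ ℕ.* q)
      swap₂ = solve 3 (λ k q′ q → q′ :* (k :* q) := k :* (q′ :* q)) refl

    powerFloor-close : ∀ {e} K → 0ℚ ≤ e → base ≤ fromℕℚ (suc K) * e →
      ∀ a a′ k k′ → a ≤ a′ + (+ 1 / suc K) →
      powerFloor a k ≤ (1ℚ + e) * (powerFloor a′ k′ + (+ 1 / suc k′))
    powerFloor-close {e} K 0≤e large a a′ k k′ h = ^-cancel-≤ K (0≤* 0≤1+e 0≤s) (begin
      powerFloor a k ^ℚ suc K        ≤⟨ compare a a′ K (powerFloor-nonNeg a k) 0≤s h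
                                          (powerFloor-lower a k) (ℚ.<⇒≤ (powerFloor-upper a′ k′)) ⟩
      base * s ^ℚ suc K              ≤⟨ *-monoʳ (s ^ℚ suc K) (^-nonNeg (suc K) 0≤s) base≤ ⟩
      (1ℚ + e) ^ℚ suc K * s ^ℚ suc K ≡⟨ ^ℚ-distrib-* (1ℚ + e) s (suc K) ⟨
      ((1ℚ + e) * s) ^ℚ suc K        ∎)
      where
      s = powerFloor a′ k′ + (+ 1 / suc k′)
      0≤s : 0ℚ ≤ s
      0≤s = ℚ.+-mono-≤ (powerFloor-nonNeg a′ k′) (0≤/ 1 k′)
      0≤1+e : 0ℚ ≤ 1ℚ + e
      0≤1+e = ℚ.+-mono-≤ (0≤/ 1 0) 0≤e
      base≤ : base ≤ (1ℚ + e) ^ℚ suc K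
      base≤ = ℚ.≤-trans large (ℚ.≤-trans (p≤q+p (0≤/ 1 0)) (bernoulli (suc K) 0≤e))

    ≤fromℕℚ⇒ : ∀ a c → a ≤ fromℕℚ c → ↥ a ℤ.≤ + (c ℕ.* ↧ₙ a)
    ≤fromℕℚ⇒ a@(mkℚ p d _) c h = subst₂ ℤ._≤_ (ℤ.*-identityʳ p) (sym (ℤ.pos-* c (suc d)))
      (ℚᵘ.drop-*≤* (ℚᵘ.≤-respʳ-≃ (ℚ.toℚᵘ-fromℚᵘ (mkℚᵘ (+ c) 0)) (ℚ.toℚᵘ-mono-≤ h)))

    powerFloor-bounded : ∀ a c k → a ≤ fromℕℚ c → powerFloor a k ≤ base ^ℚ c
    powerFloor-bounded a c k h = ^-cancel-≤ (ℚ.denominator-1 a) (^-nonNeg c (ℚ.<⇒≤ 0<b)) (begin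
      powerFloor a k ^ℚ ↧ₙ a      ≤⟨ powerFloor-lower a k ⟩
      base ^ᶻ ↥ a                 ≤⟨ ^ᶻ-mono (≤fromℕℚ⇒ a c h) ⟩
      base ^ℚ (c ℕ.* ↧ₙ a)        ≡⟨ ^ℚ-assocʳ base c (↧ₙ a) ⟨
      (base ^ℚ c) ^ℚ ↧ₙ a         ∎)

    powerFloor-large : ∀ a c k → - a ≤ fromℕℚ c → base ^ᶻ (ℤ.- + c) ≤ powerFloor a k + (+ 1 / suc k)
    powerFloor-large a c k h = ℚ.<⇒≤ (^-cancel-< (↧ₙ a) (ℚ.+-mono-≤ (powerFloor-nonNeg a k) (0≤/ 1 k)) (begin-strict
      (base ^ᶻ (ℤ.- + c)) ^ℚ ↧ₙ a               ≡⟨ ^ᶻ-^ (ℤ.- + c) (↧ₙ a) ⟩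
      base ^ᶻ (ℤ.- + c ℤ.* + ↧ₙ a)              ≤⟨ ^ᶻ-mono -cq≤ ⟩
      base ^ᶻ ↥ a                               <⟨ powerFloor-upper a k ⟩
      (powerFloor a k + (+ 1 / suc k)) ^ℚ ↧ₙ a  ∎))
      where
      -cq≤ : ℤ.- + c ℤ.* + ↧ₙ a ℤ.≤ ↥ a
      -cq≤ = subst₂ ℤ._≤_
        (trans (cong ℤ.-_ (trans (cong (λ w → + (c ℕ.* w)) (ℤ.+-injective (ℚ.↧-neg a))) (ℤ.pos-* c (↧ₙ a))))
               (ℤ.neg-distribˡ-* (+ c) (+ ↧ₙ a)))
        (trans (cong ℤ.-_ (ℚ.↥-neg a)) (ℤ.neg-involutive (↥ a)))
        (ℤ.neg-mono-≤ (≤fromℕℚ⇒ (- a) c h))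

Eventually : (ℕ → Set) → Set
Eventually P = ∃[ N ] (∀ n → N ℕ.≤ n → P n)

IsCauchy : (ℕ → ℚ) → Set
IsCauchy f = ∀ ε → 0ℚ ℚ.< ε → ∃[ N ] (∀ m n → N ℕ.≤ m → N ℕ.≤ n → ℚ.∣ f m ℚ.- f n ∣ ℚ.≤ ε)

module CauchyLemmas where
  open import Data.Rational.Base
  open ℚ.≤-Reasoning

  one-sided : ∀ f → (∀ ε → 0ℚ < ε → ∃[ N ] (∀ m n → N ℕ.≤ m → N ℕ.≤ n → f m ≤ f n + ε)) → IsCauchy f
  one-sided f h ε 0<ε = let N , b = h ε 0<ε in
    N , λ m n N≤m N≤n → ≤⇒∣-∣≤ (b m n N≤m N≤n) (b n m N≤n N≤m)

  cauchy-const : ∀ q → IsCauchy (λ _ → q)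
  cauchy-const q ε 0<ε = 0 , λ _ _ _ _ → subst (λ w → ∣ w ∣ ≤ _) (sym (ℚ.+-inverseʳ q)) (ℚ.<⇒≤ 0<ε)

  cauchy-+ : ∀ f g → IsCauchy f → IsCauchy g → IsCauchy (λ n → f n + g n)
  cauchy-+ f g cf cg ε 0<ε = let M , hf = cf (½ * ε) (0<½* 0<ε) ; N , hg = cg (½ * ε) (0<½* 0<ε) in
    M ℕ.⊔ N , λ m n ≤m ≤n → begin
      ∣ (f m + g m) - (f n + g n) ∣        ≡⟨ cong ∣_∣ (regroup (f m) (g m) (f n) (g n)) ⟩
      ∣ (f m - f n) + (g m - g n) ∣        ≤⟨ ℚ.∣p+q∣≤∣p∣+∣q∣ (f m - f n) (g m - g n) ⟩
      ∣ f m - f n ∣ + ∣ g m - g n ∣        ≤⟨ ℚ.+-mono-≤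
                                               (hf m n (ℕ.m⊔n≤o⇒m≤o M N ≤m) (ℕ.m⊔n≤o⇒m≤o M N ≤n))
                                               (hg m n (ℕ.m⊔n≤o⇒n≤o M N ≤m) (ℕ.m⊔n≤o⇒n≤o M N ≤n)) ⟩
      ½ * ε + ½ * ε                        ≡⟨ ½+½ ε ⟩
      ε                                    ∎
    where
    open +-*-Solver
    regroup : ∀ a b c d → (a + b) - (c + d) ≡ (a - c) + (b - d)
    regroup = solve 4 (λ a b c d → (a :+ b) :- (c :+ d) := (a :- c) :+ (b :- d)) refl

  cauchy-neg : ∀ f → IsCauchy f → IsCauchy (λ n → - f n)
  cauchy-neg f cf ε 0<ε = let N , h = cf ε 0<ε in
    N , λ m n ≤m ≤n → subst (_≤ ε) (cong ∣_∣ (swap (f n) (f m))) (h n m ≤n ≤m)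
    where
    open +-*-Solver
    swap : ∀ a b → a - b ≡ - b - - a
    swap = solve 2 (λ a b → a :- b := :- b :- :- a) refl

  bounded-above : ∀ f → IsCauchy f → ∃[ c ] Eventually (λ n → f n ≤ fromℕℚ (suc c))
  bounded-above f cf = let N , h = cf 1ℚ (0<1/ 0) ; c , b = archimedean (f N + 1ℚ) in
    c , N , λ n N≤n → ℚ.≤-trans (∣-∣≤⇒≤ (h n N N≤n ℕ.≤-refl)) b

  bounded-below : ∀ f → IsCauchy f → ∃[ c ] Eventually (λ n → - f n ≤ fromℕℚ (suc c))
  bounded-below f cf = bounded-above (λ n → - f n) (cauchy-neg f cf)

  bounded : ∀ f → IsCauchy f → ∃[ c ] Eventually (λ n → ∣ f n ∣ ≤ fromℕℚ (suc c))
  bounded f cf = let N , h = cf 1ℚ (0<1/ 0) ; c , b = archimedean (1ℚ + ∣ f N ∣) in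
    c , N , λ n N≤n → begin
      ∣ f n ∣                       ≡⟨ cong ∣_∣ (minus-plus (f n) (f N)) ⟨
      ∣ (f n - f N) + f N ∣         ≤⟨ ℚ.∣p+q∣≤∣p∣+∣q∣ (f n - f N) (f N) ⟩
      ∣ f n - f N ∣ + ∣ f N ∣       ≤⟨ ℚ.+-monoˡ-≤ ∣ f N ∣ (h n N N≤n ℕ.≤-refl) ⟩
      1ℚ + ∣ f N ∣                  ≤⟨ b ⟩
      fromℕℚ (suc c)                ∎

  cauchy-* : ∀ f g → IsCauchy f → IsCauchy g → IsCauchy (λ n → f n * g n)
  cauchy-* f g cf cg ε 0<ε =
    let c , M₁ , bf = bounded f cf
        d , M₂ , bg = bounded g cg
        δ₁ , 0<δ₁ , small₁ = shrink (fromℕℚ (suc d)) (0<½* 0<ε)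
        δ₂ , 0<δ₂ , small₂ = shrink (fromℕℚ (suc c)) (0<½* 0<ε)
        M₃ , hf = cf δ₁ 0<δ₁
        M₄ , hg = cg δ₂ 0<δ₂
        M = (M₁ ℕ.⊔ M₂) ℕ.⊔ (M₃ ℕ.⊔ M₄)
        ≥₁₂ : ∀ {n} → M ℕ.≤ n → M₁ ℕ.⊔ M₂ ℕ.≤ n
        ≥₁₂ = ℕ.m⊔n≤o⇒m≤o (M₁ ℕ.⊔ M₂) (M₃ ℕ.⊔ M₄)
        ≥₃₄ : ∀ {n} → M ℕ.≤ n → M₃ ℕ.⊔ M₄ ℕ.≤ n
        ≥₃₄ = ℕ.m⊔n≤o⇒n≤o (M₁ ℕ.⊔ M₂) (M₃ ℕ.⊔ M₄)
    in M , λ m n ≤m ≤n → begin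
      ∣ f m * g m - f n * g n ∣                         ≡⟨ cong ∣_∣ (regroup (f m) (g m) (f n) (g n)) ⟩
      ∣ (f m - f n) * g m + (g m - g n) * f n ∣         ≤⟨ ℚ.∣p+q∣≤∣p∣+∣q∣ ((f m - f n) * g m) ((g m - g n) * f n) ⟩
      ∣ (f m - f n) * g m ∣ + ∣ (g m - g n) * f n ∣     ≡⟨ cong₂ _+_ (ℚ.∣p*q∣≡∣p∣*∣q∣ (f m - f n) (g m)) (ℚ.∣p*q∣≡∣p∣*∣q∣ (g m - g n) (f n)) ⟩
      ∣ f m - f n ∣ * ∣ g m ∣ + ∣ g m - g n ∣ * ∣ f n ∣
        ≤⟨ ℚ.+-mono-≤
             (*-mono-nonNeg (ℚ.<⇒≤ 0<δ₁) (ℚ.0≤∣p∣ (g m))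
               (hf m n (ℕ.m⊔n≤o⇒m≤o M₃ M₄ (≥₃₄ ≤m)) (ℕ.m⊔n≤o⇒m≤o M₃ M₄ (≥₃₄ ≤n)))
               (bg m (ℕ.m⊔n≤o⇒n≤o M₁ M₂ (≥₁₂ ≤m))))
             (*-mono-nonNeg (ℚ.<⇒≤ 0<δ₂) (ℚ.0≤∣p∣ (f n))
               (hg m n (ℕ.m⊔n≤o⇒n≤o M₃ M₄ (≥₃₄ ≤m)) (ℕ.m⊔n≤o⇒n≤o M₃ M₄ (≥₃₄ ≤n)))
               (bf n (ℕ.m⊔n≤o⇒m≤o M₁ M₂ (≥₁₂ ≤n)))) ⟩
      δ₁ * fromℕℚ (suc d) + δ₂ * fromℕℚ (suc c)         ≤⟨ ℚ.+-mono-≤ small₁ small₂ ⟩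
      ½ * ε + ½ * ε                                     ≡⟨ ½+½ ε ⟩
      ε                                                 ∎
    where
    open +-*-Solver
    regroup : ∀ a b c d → a * b - c * d ≡ (a - c) * b + (b - d) * c
    regroup = solve 4 (λ a b c d → a :* b :- c :* d := (a :- c) :* b :+ (b :- d) :* c) refl

  cauchy-inv : ∀ f {e} → IsCauchy f → 0ℚ < e → Eventually (λ n → e ≤ f n) → IsCauchy (λ n → inv (f n))
  cauchy-inv f {e} cf 0<e (M , e≤f) ε 0<ε =
    let δ , 0<δ , small₁ = shrink (inv e * inv e) 0<ε
        N , h = cf δ 0<δ
    in M ℕ.⊔ N , λ m n ≤m ≤n →
      let em = e≤f m (ℕ.m⊔n≤o⇒m≤o M N ≤m)
          en = e≤f n (ℕ.m⊔n≤o⇒m≤o M N ≤n)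
          0<m = ℚ.<-≤-trans 0<e em
          0<n = ℚ.<-≤-trans 0<e en
          0≤im = ℚ.<⇒≤ (inv-pos 0<m)
          0≤in = ℚ.<⇒≤ (inv-pos 0<n)
      in begin
      ∣ inv (f m) - inv (f n) ∣                           ≡⟨ cong ∣_∣ (difference (f m) (f n) {inv (f m)} {inv (f n)} (inv-inverse 0<m) (inv-inverse 0<n)) ⟩
      ∣ (f n - f m) * (inv (f m) * inv (f n)) ∣           ≡⟨ ℚ.∣p*q∣≡∣p∣*∣q∣ (f n - f m) (inv (f m) * inv (f n)) ⟩
      ∣ f n - f m ∣ * ∣ inv (f m) * inv (f n) ∣           ≡⟨ cong (∣ f n - f m ∣ *_) (ℚ.0≤p⇒∣p∣≡p (0≤* 0≤im 0≤in)) ⟩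
      ∣ f n - f m ∣ * (inv (f m) * inv (f n))
        ≤⟨ *-mono-nonNeg (ℚ.<⇒≤ 0<δ) (0≤* 0≤im 0≤in)
             (h n m (ℕ.m⊔n≤o⇒n≤o M N ≤n) (ℕ.m⊔n≤o⇒n≤o M N ≤m))
             (*-mono-nonNeg (ℚ.<⇒≤ (inv-pos 0<e)) 0≤in (inv-anti 0<e em) (inv-anti 0<e en)) ⟩
      δ * (inv e * inv e)                                 ≤⟨ small₁ ⟩
      ε                                                   ∎
    where
    open +-*-Solver
    regroup : ∀ a b i j → i * (j * b) - j * (i * a) ≡ (b - a) * (i * j)
    regroup = solve 4 (λ a b i j → i :* (j :* b) :- j :* (i :* a) := (b :- a) :* (i :* j)) refl
    difference : ∀ a b {i j} → i * a ≡ 1ℚ → j * b ≡ 1ℚ → i - j ≡ (b - a) * (i * j)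
    difference a b {i} {j} ia jb = begin-equality
      i - j                         ≡⟨ cong₂ _-_ (ℚ.*-identityʳ i) (ℚ.*-identityʳ j) ⟨
      i * 1ℚ - j * 1ℚ               ≡⟨ cong₂ (λ u v → i * u - j * v) jb ia ⟨
      i * (j * b) - j * (i * a)     ≡⟨ regroup a b i j ⟩
      (b - a) * (i * j)             ∎

  module _ (n : ℕ) where
    open IntegerPower (base n) (1≤fromℕℚ n)
    open PowerFloorLemmas n

    cauchy-power : ∀ f → IsCauchy f → IsCauchy (λ k → powerFloor n (f k) k)
    cauchy-power f cf = one-sided (λ k → powerFloor n (f k) k) λ ε 0<ε →
      let c , M₁ , b = bounded-above f cf
          R = base n ^ℚ suc c
          e , 0<e , small₁ = shrink (R + 1ℚ) (0<½* 0<ε)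
          K , large = grow 0<e (base n)
          M₂ , h = cf (+ 1 / suc K) (0<1/ K)
          M₃ , small₂ = small (0<½* 0<ε)
          M = M₁ ℕ.⊔ (M₂ ℕ.⊔ M₃)
          ≥₂₃ : ∀ {k} → M ℕ.≤ k → M₂ ℕ.⊔ M₃ ℕ.≤ k
          ≥₂₃ = ℕ.m⊔n≤o⇒n≤o M₁ (M₂ ℕ.⊔ M₃)
      in M , λ k l ≤k ≤l →
      let r = powerFloor n (f l) l
          u = + 1 / suc l
      in begin
        powerFloor n (f k) k       ≤⟨ powerFloor-close K (ℚ.<⇒≤ 0<e) large (f k) (f l) k l
                                        (∣-∣≤⇒≤ (h k l (ℕ.m⊔n≤o⇒m≤o M₂ M₃ (≥₂₃ ≤k)) (ℕ.m⊔n≤o⇒m≤o M₂ M₃ (≥₂₃ ≤l)))) ⟩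
        (1ℚ + e) * (r + u)         ≡⟨ expand e r u ⟩
        r + (u + e * (r + u))      ≤⟨ ℚ.+-monoʳ-≤ r (ℚ.+-mono-≤
                                        (ℚ.≤-trans (1/-anti (ℕ.m⊔n≤o⇒n≤o M₂ M₃ (≥₂₃ ≤l))) small₂)
                                        (ℚ.≤-trans (*-monoˡ e (ℚ.<⇒≤ 0<e)
                                          (ℚ.+-mono-≤ (powerFloor-bounded (f l) (suc c) l (b l (ℕ.m⊔n≤o⇒m≤o M₁ _ ≤l)))
                                                      (1/-anti {0} {l} ℕ.z≤n)))
                                          small₁)) ⟩
        r + (½ * ε + ½ * ε)        ≡⟨ cong (λ w → r + w) (½+½ ε) ⟩
        r + ε                      ∎
      where
      open +-*-Solver
      expand : ∀ e r u → (1ℚ + e) * (r + u) ≡ r + (u + e * (r + u))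
      expand = solve 3 (λ e r u → (con 1ℚ :+ e) :* (r :+ u) := r :+ (u :+ e :* (r :+ u))) refl

    power-positive : ∀ f → IsCauchy f →
      ∃[ ε ] (0ℚ < ε × Eventually (λ k → ε ≤ powerFloor n (f k) k))
    power-positive f cf =
      let c , M₁ , b = bounded-below f cf
          β = base n ^ᶻ (ℤ.- + suc c)
          0<½β = 0<½* (^ᶻ-pos (ℤ.- + suc c))
          M₂ , small₁ = small 0<½β
      in ½ * β , 0<½β , M₁ ℕ.⊔ M₂ , λ k ≤k →
      let r = powerFloor n (f k) k in begin
        ½ * β              ≡⟨ half β ⟩
        β - ½ * β          ≤⟨ ≤⇒minus≤ (begin
            β                      ≤⟨ powerFloor-large (f k) (suc c) k (b k (ℕ.m⊔n≤o⇒m≤o M₁ M₂ ≤k)) ⟩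
            r + (+ 1 / suc k)      ≤⟨ ℚ.+-monoʳ-≤ r (ℚ.≤-trans (1/-anti (ℕ.m⊔n≤o⇒n≤o M₁ M₂ ≤k)) small₁) ⟩
            r + ½ * β              ≡⟨ ℚ.+-comm r (½ * β) ⟩
            ½ * β + r              ∎) ⟩
        r                  ∎
      where
      half : ∀ b → ½ * b ≡ b - ½ * b
      half b = sym (trans (cong (_- ½ * b) (sym (½+½ b))) (plus-minus (½ * b) (½ * b)))

open CauchyLemmas

record ℝ : Set where
  constructor mkℝ
  field
    seq      : ℕ → ℚ
    isCauchy : IsCauchy seq

open ℝ public

infix  4 _≈_ _≤_ _<_
infixl 6 _+_
infixl 7 _*_ _÷_⟨_⟩
infix  8 -_
infixr 9 _^_

_≈_ : Rel ℝ 0ℓ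
x ≈ y = ∀ ε → 0ℚ ℚ.< ε → Eventually λ n → ℚ.∣ seq x n ℚ.- seq y n ∣ ℚ.≤ ε

_≤_ : Rel ℝ 0ℓ
x ≤ y = ∀ ε → 0ℚ ℚ.< ε → Eventually λ n → seq x n ℚ.≤ seq y n ℚ.+ ε

_<_ : Rel ℝ 0ℓ
x < y = ∃[ ε ] (0ℚ ℚ.< ε × Eventually λ n → seq x n ℚ.+ ε ℚ.≤ seq y n)

fromℚ : ℚ → ℝ
fromℚ q = mkℝ (λ _ → q) (cauchy-const q)

fromℕ : ℕ → ℝ
fromℕ n = fromℚ (fromℕℚ n)

0ℝ 1ℝ : ℝ
0ℝ = fromℚ 0ℚ
1ℝ = fromℚ 1ℚ

_+_ : ℝ → ℝ → ℝ
x + y = mkℝ (λ n → seq x n ℚ.+ seq y n) (cauchy-+ (seq x) (seq y) (isCauchy x) (isCauchy y))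

-_ : ℝ → ℝ
- x = mkℝ (λ n → ℚ.- seq x n) (cauchy-neg (seq x) (isCauchy x))

_*_ : ℝ → ℝ → ℝ
x * y = mkℝ (λ n → seq x n ℚ.* seq y n) (cauchy-* (seq x) (seq y) (isCauchy x) (isCauchy y))

positive-bound : ∀ {x} → 0ℝ < x → ∃[ ε ] (0ℚ ℚ.< ε × Eventually λ n → ε ℚ.≤ seq x n)
positive-bound (ε , 0<ε , N , h) =
  ε , 0<ε , N , λ n N≤n → ℚ.≤-trans (ℚ.≤-reflexive (sym (ℚ.+-identityˡ ε))) (h n N≤n)

bound-positive : ∀ {x} → ∃[ ε ] (0ℚ ℚ.< ε × Eventually λ n → ε ℚ.≤ seq x n) → 0ℝ < x
bound-positive (ε , 0<ε , N , h) =
  ε , 0<ε , N , λ n N≤n → ℚ.≤-trans (ℚ.≤-reflexive (ℚ.+-identityˡ ε)) (h n N≤n)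

_÷_⟨_⟩ : (x y : ℝ) → 0ℝ < y → ℝ
x ÷ y ⟨ 0<y ⟩ = x * mkℝ (λ n → inv (seq y n))
  (let ε , 0<ε , h = positive-bound {y} 0<y in cauchy-inv (seq y) (isCauchy y) 0<ε h)

-- b ^ α is the limit of b to the rational powers α₀, α₁, …, the k-th of these
-- being replaced by its approximation from below to within 1/(k+1).  The value
-- at base 0 is the usual one for α > 0; for other α it is a convention.
_^_ : ℕ → ℝ → ℝ
zero  ^ α = 0ℝ
suc n ^ α = mkℝ (λ k → powerFloor n (seq α k) k) (cauchy-power n (seq α) (isCauchy α))

^-positive : ∀ {b} α → 0 ℕ.< b → 0ℝ < b ^ α
^-positive {suc n} α _ = bound-positive {suc n ^ α} (power-positive n (seq α) (isCauchy α))

+-positive : ∀ {x y} → 0ℝ < x → 0ℝ < y → 0ℝ < x + y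
+-positive {x} {y} 0<x 0<y =
  let ε , 0<ε , M , h = positive-bound {x} 0<x
      δ , 0<δ , N , k = positive-bound {y} 0<y
  in bound-positive {x + y} (ε ℚ.+ δ , ℚ.+-mono-< 0<ε 0<δ , M ℕ.⊔ N ,
       λ n ≤n → ℚ.+-mono-≤ (h n (ℕ.m⊔n≤o⇒m≤o M N ≤n)) (k n (ℕ.m⊔n≤o⇒n≤o M N ≤n)))

1÷-positive : ∀ {y} (0<y : 0ℝ < y) → 0ℝ < 1ℝ ÷ y ⟨ 0<y ⟩
1÷-positive {y} 0<y =
  let ε , 0<ε , M , h = positive-bound {y} 0<y
      c , N , b = bounded-above (seq y) (isCauchy y)
  in bound-positive {1ℝ ÷ y ⟨ 0<y ⟩} (inv (fromℕℚ (suc c)) , inv-pos (ℚ.<-≤-trans (0<1/ 0) (1≤fromℕℚ c)) , M ℕ.⊔ N ,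
       λ n ≤n → subst (inv (fromℕℚ (suc c)) ℚ.≤_) (sym (ℚ.*-identityˡ (inv (seq y n))))
         (inv-anti (ℚ.<-≤-trans 0<ε (h n (ℕ.m⊔n≤o⇒m≤o M N ≤n))) (b n (ℕ.m⊔n≤o⇒n≤o M N ≤n))))

∑ : {A : Set} → List A → (A → ℝ) → ℝ
∑ xs f = foldr (λ x s → f x + s) 0ℝ xs

∑-positive : {A : Set} (xs : List A) {f : A → ℝ} →
             0 ℕ.< length xs → (∀ x → 0ℝ < f x) → 0ℝ < ∑ xs f
∑-positive (x ∷ [])     {f} _ 0<f =
  let ε , 0<ε , N , h = positive-bound {f x} (0<f x) in
  bound-positive {f x + 0ℝ} (ε , 0<ε , N , λ n N≤n →
    ℚ.≤-trans (h n N≤n) (ℚ.≤-reflexive (sym (ℚ.+-identityʳ (seq (f x) n)))))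
∑-positive (x ∷ y ∷ xs) {f} _ 0<f =
  +-positive {f x} {∑ (y ∷ xs) f} (0<f x) (∑-positive (y ∷ xs) {f} (ℕ.s≤s ℕ.z≤n) 0<f)

record Graph (n : ℕ) : Set₁ where
  field
    _~_    : Rel (Fin n) 0ℓ
    _~?_   : Decidable _~_
    ~-sym  : Symmetric _~_
    ~-irr  : ∀ {v} → ¬ (v ~ v)

  degree : Fin n → ℕ
  degree v = length (filter (v ~?_) (allFin n))

  -- Each undirected edge is represented once, with its smaller endpoint first.
  record Edge : Set where
    constructor edge
    field
      fst snd  : Fin n
      ordered  : fst Fin.< snd
      adjacent : fst ~ snd

  edge? : Fin n × Fin n → Maybe Edge
  edge? (u , v) = Maybe.map (λ (u<v , u~v) → edge u v u<v u~v) (dec⇒maybe ((u Fin.<? v) ×-dec (u ~? v)))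

  edges : List Edge
  edges = mapMaybe edge? (cartesianProduct (allFin n) (allFin n))

  size : ℕ
  size = length edges

  IsMinDegree : ℕ → Set
  IsMinDegree δ = (∀ v → δ ℕ.≤ degree v) × ∃[ v ] degree v ≡ δ

  Regular : Set
  Regular = ∀ u v → degree u ≡ degree v

  ~⇒degree>0 : ∀ {u v} → u ~ v → 0 ℕ.< degree u
  ~⇒degree>0 {u} {v} u~v = ∈-length (∈-filter⁺ (u ~?_) (∈-allFin v) u~v)

  module _ (α : ℝ) (e : Edge) where
    open Edge e

    dᵤ^ dᵥ^ : ℝ
    dᵤ^ = degree fst ^ α
    dᵥ^ = degree snd ^ α

    0<dᵤ^ : 0ℝ < dᵤ^
    0<dᵤ^ = ^-positive α (~⇒degree>0 adjacent)

    0<dᵥ^ : 0ℝ < dᵥ^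
    0<dᵥ^ = ^-positive α (~⇒degree>0 (~-sym adjacent))

    0<dᵤ^+dᵥ^ : 0ℝ < dᵤ^ + dᵥ^
    0<dᵤ^+dᵥ^ = +-positive {dᵤ^} {dᵥ^} 0<dᵤ^ 0<dᵥ^

  SDD : ℝ → ℝ
  SDD α = ∑ edges λ e →
    dᵤ^ α e ÷ dᵥ^ α e ⟨ 0<dᵥ^ α e ⟩ + dᵥ^ α e ÷ dᵤ^ α e ⟨ 0<dᵤ^ α e ⟩

  ISD : ℝ → ℝ
  ISD a = ∑ edges λ e → 1ℝ ÷ (dᵤ^ a e + dᵥ^ a e) ⟨ 0<dᵤ^+dᵥ^ a e ⟩

  ISD-positive : ∀ a → 1 ℕ.≤ size → 0ℝ < ISD a
  ISD-positive a m≥1 = ∑-positive edges {λ e → 1ℝ ÷ (dᵤ^ a e + dᵥ^ a e) ⟨ 0<dᵤ^+dᵥ^ a e ⟩} m≥1 λ e →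
    1÷-positive {dᵤ^ a e + dᵥ^ a e} (0<dᵤ^+dᵥ^ a e)

{-# OPTIONS --safe #-}
module Submission where

-- Put D = δ^α and, for an edge with x = d_u^α and y = d_v^α, let B = xy/(x + y)
-- be its contribution to S = ISD_{-α}, so that 1/B = 1/x + 1/y.  With t = m/S,
--
--   x/y + y/x = D(2t − t²B) + defect,
--   defect = D(1/x + 1/y)(1 − tB)² + ½(1/x + 1/y)((x − D) + (y − D)) + ½(x − y)²/(xy).
--
-- Summing over the edges, the first part gives D(2tm − t²S) = Dm²/S, and every
-- defect is nonnegative because x, y ≥ D.  An endpoint of degree above δ makes
-- the middle term of its defects positive, whereas x = y = D on all edges makes
-- all the B equal, so that tB = 1 and the defects vanish.

open import Defs
open import Data.Nat as ℕ using (ℕ)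
open import Data.Product using (_×_)
open import Function.Bundles using (_⇔_)
open import Data.Empty using (⊥; ⊥-elim)
open import Data.Integer as ℤ using (+_; -[1+_])
import Data.Integer.Properties as ℤ
open import Data.Fin as Fin using (Fin)
import Data.Fin.Properties as Fin
open import Data.List using (List; []; _∷_; length; filter; foldr; map; allFin; cartesianProduct)
open import Data.List.Membership.Propositional using (lose)
open import Data.List.Membership.Propositional.Properties using (∈-filter⁻; ∈-allFin; ∈-cartesianProduct⁺)
open import Data.List.Relation.Unary.Any as Any using (Any; here; there)
import Data.List.Relation.Unary.Any.Properties as Any
open import Data.Maybe.Relation.Unary.Any as MAny using (just)
open import Data.Nat using (zero; suc)
import Data.Nat.Properties as ℕ
open import Data.Product using (∃-syntax; _,_; proj₂)
open import Data.Rational as ℚ using (ℚ; 0ℚ; 1ℚ; ½; ↥_; ↧ₙ_; mkℚ)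
  renaming (_+_ to _∔_; _*_ to _·_; _-_ to _−_)
import Data.Rational.Properties as ℚ
open import Data.Rational.Solver using (module +-*-Solver)
open import Data.Rational.Unnormalised using (mkℚᵘ)
import Data.Rational.Unnormalised.Properties as ℚᵘ
open import Data.Sum using (_⊎_; inj₁; inj₂; [_,_]′)
open import Function.Bundles using (mk⇔)
open import Relation.Binary.Definitions using (tri<; tri≈; tri>)
open import Relation.Binary.PropositionalEquality
open import Relation.Nullary using (yes; no)
open import Relation.Nullary.Decidable using (_×-dec_)

open RationalLemmas
open CauchyLemmas
open ℚ.≤-Reasoning

-- Upper estimates for natural powers of 1 + e.

1^ : ∀ k → 1ℚ ^ℚ k ≡ 1ℚ
1^ zero    = refl
1^ (suc k) = trans (ℚ.*-identityˡ (1ℚ ^ℚ k)) (1^ k)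

-- An upper counterpart of Bernoulli's inequality on [0, 1]. In the induction step e ≤ 1 absorbs the
-- quadratic term e²C into eC, so C becomes 1 + 2C, that is, C = 2^k - 1.
^-linear-bound : ∀ k → ∃[ C ] (0ℚ ℚ.≤ C × (∀ {e} → 0ℚ ℚ.≤ e → e ℚ.≤ 1ℚ → (1ℚ ∔ e) ^ℚ k ℚ.≤ 1ℚ ∔ e · C))
^-linear-bound zero    = 0ℚ , ℚ.≤-refl , λ {e} _ _ → ℚ.≤-reflexive (sym (trans (cong (1ℚ ∔_) (ℚ.*-zeroʳ e)) (ℚ.+-identityʳ 1ℚ)))
^-linear-bound (suc k) = let C , 0≤C , h = ^-linear-bound k in
  1ℚ ∔ (C ∔ C) , ℚ.+-mono-≤ (0≤/ 1 0) (ℚ.+-mono-≤ 0≤C 0≤C) , λ {e} 0≤e e≤1 → begin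
    (1ℚ ∔ e) · (1ℚ ∔ e) ^ℚ k        ≤⟨ *-monoˡ (1ℚ ∔ e) (ℚ.+-mono-≤ (0≤/ 1 0) 0≤e) (h 0≤e e≤1) ⟩
    (1ℚ ∔ e) · (1ℚ ∔ e · C)         ≡⟨ expand e C ⟩
    1ℚ ∔ e · (1ℚ ∔ C) ∔ e · (e · C) ≤⟨ ℚ.+-monoʳ-≤ (1ℚ ∔ e · (1ℚ ∔ C)) (*-monoˡ e 0≤e (*-monoʳ C 0≤C e≤1)) ⟩
    1ℚ ∔ e · (1ℚ ∔ C) ∔ e · (1ℚ · C) ≡⟨ collect e C ⟩
    1ℚ ∔ e · (1ℚ ∔ (C ∔ C))         ∎
  where
  open +-*-Solver
  expand : ∀ e C → (1ℚ ∔ e) · (1ℚ ∔ e · C) ≡ 1ℚ ∔ e · (1ℚ ∔ C) ∔ e · (e · C)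
  expand = solve 2 (λ e C → (con 1ℚ :+ e) :* (con 1ℚ :+ e :* C)
                          := con 1ℚ :+ e :* (con 1ℚ :+ C) :+ e :* (e :* C)) refl
  collect : ∀ e C → 1ℚ ∔ e · (1ℚ ∔ C) ∔ e · (1ℚ · C) ≡ 1ℚ ∔ e · (1ℚ ∔ (C ∔ C))
  collect = solve 2 (λ e C → con 1ℚ :+ e :* (con 1ℚ :+ C) :+ e :* (con 1ℚ :* C)
                           := con 1ℚ :+ e :* (con 1ℚ :+ (C :+ C))) refl

-- Distinct bases differ by at least 1, which leaves room for a factor (1 + e)^K with small e. For
-- positive K this separates the K-th roots of the bases by a ratio 1 + e > 1, the source of strict
-- monotonicity of real powers.
root-gap : ∀ {n n′} K → n ℕ.< n′ → ∃[ e ] (0ℚ ℚ.< e × (1ℚ ∔ e) ^ℚ K · base n ℚ.≤ base n′)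
root-gap {n} {n′} K n<n′ =
  let C , 0≤C , h = ^-linear-bound K
      0≤b = 0≤/ (suc n) 0
      -- From e(1 + C · `base n`) ≤ 1 follow both e ≤ 1, needed for the linear bound, and eC ·
      -- `base n` ≤ 1, the gap between consecutive bases.
      e , 0<e , small₁ = shrink (1ℚ ∔ C · base n) (0<1/ 0)
      0≤e = ℚ.<⇒≤ 0<e
      fits = ℚ.≤-trans (ℚ.≤-reflexive (sym (ℚ.*-distribˡ-+ e 1ℚ (C · base n)))) small₁
      e≤1 = begin
        e                       ≡⟨ ℚ.*-identityʳ e ⟨
        e · 1ℚ                  ≤⟨ p≤q+p (0≤* 0≤e (0≤* 0≤C 0≤b)) ⟩
        e · (C · base n) ∔ e · 1ℚ ≡⟨ ℚ.+-comm (e · (C · base n)) (e · 1ℚ) ⟩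
        e · 1ℚ ∔ e · (C · base n) ≤⟨ fits ⟩
        1ℚ                      ∎
  in e , 0<e , (begin
    (1ℚ ∔ e) ^ℚ K · base n          ≤⟨ *-monoʳ (base n) 0≤b (h 0≤e e≤1) ⟩
    (1ℚ ∔ e · C) · base n           ≡⟨ expand e C (base n) ⟩
    e · (C · base n) ∔ base n       ≤⟨ ℚ.+-monoˡ-≤ (base n) (ℚ.≤-trans (p≤q+p (0≤* 0≤e (0≤/ 1 0))) fits) ⟩
    1ℚ ∔ base n                     ≡⟨ fromℕℚ-suc (suc n) ⟨
    base (suc n)                    ≤⟨ /-mono 0 (ℕ.s≤s n<n′) ⟩
    base n′                         ∎)
  where
  open +-*-Solver
  expand : ∀ e C b → (1ℚ ∔ e · C) · b ≡ e · (C · b) ∔ b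
  expand = solve 3 (λ e C b → (con 1ℚ :+ e :* C) :* b := e :* (C :* b) :+ b) refl

-- Rounded rational powers: reciprocals and growth in the base.

module _ (n : ℕ) where
  open IntegerPower (base n) (1≤fromℕℚ n)
  open PowerFloorLemmas n

  ^ᶻ-inverse : ∀ z → base n ^ᶻ z · base n ^ᶻ (ℤ.- z) ≡ 1ℚ
  ^ᶻ-inverse (+ k)    = trans (sym (^ᶻ-plus k (ℤ.- + k))) (cong (base n ^ᶻ_) (ℤ.+-inverseʳ (+ k)))
  ^ᶻ-inverse -[1+ k ] = trans (ℚ.*-comm (base n ^ᶻ -[1+ k ]) (base n ^ᶻ + suc k)) (^ᶻ-inverse (+ suc k))

  -- With u = 1/(k+1), the roundings satisfy r ≤ b^a ≤ r + u and s ≤ b^(-a) ≤ s + u, hence rs ≤ 1 ≤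
  -- (r + u)(s + u) = rs + (r + s + u)u. As b^a may be irrational, everything is compared after
  -- raising to the power q. Weakening the inner u to 1 leaves a factor that is Cauchy in k.
  powerFloor-reciprocal : ∀ a k → let r = powerFloor n a k ; s = powerFloor n (ℚ.- a) k in
    ℚ.∣ r · s − 1ℚ ∣ ℚ.≤ (r ∔ s ∔ 1ℚ) · (+ 1 ℚ./ suc k)
  powerFloor-reciprocal a k = ≤⇒∣-∣≤ upper lower
    where
    r = powerFloor n a k
    s = powerFloor n (ℚ.- a) k
    u = + 1 ℚ./ suc k
    q = ↧ₙ a
    0≤r = powerFloor-nonNeg a k
    0≤s = powerFloor-nonNeg (ℚ.- a) k
    0≤u = 0≤/ 1 k
    -- That a and -a have the same denominator and opposite numerators holds only propositionally,
    -- hence the transport.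
    s^q≤ : s ^ℚ q ℚ.≤ base n ^ᶻ (ℤ.- ↥ a)
    s^q≤ = subst₂ (λ i z → s ^ℚ i ℚ.≤ base n ^ᶻ z) (ℤ.+-injective (ℚ.↧-neg a)) (ℚ.↥-neg a) (powerFloor-lower (ℚ.- a) k)
    <s+u^q : base n ^ᶻ (ℤ.- ↥ a) ℚ.< (s ∔ u) ^ℚ q
    <s+u^q = subst₂ (λ i z → base n ^ᶻ z ℚ.< (s ∔ u) ^ℚ i) (ℤ.+-injective (ℚ.↧-neg a)) (ℚ.↥-neg a) (powerFloor-upper (ℚ.- a) k)
    rs≤1 : r · s ℚ.≤ 1ℚ
    rs≤1 = ^-cancel-≤ (ℚ.denominator-1 a) (0≤/ 1 0) (begin
      (r · s) ^ℚ q                            ≡⟨ ^ℚ-distrib-* r s q ⟩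
      r ^ℚ q · s ^ℚ q                         ≤⟨ *-mono-nonNeg (ℚ.<⇒≤ (^ᶻ-pos (↥ a))) (^-nonNeg q 0≤s) (powerFloor-lower a k) s^q≤ ⟩
      base n ^ᶻ ↥ a · base n ^ᶻ (ℤ.- ↥ a)     ≡⟨ ^ᶻ-inverse (↥ a) ⟩
      1ℚ                                      ≡⟨ 1^ q ⟨
      1ℚ ^ℚ q                                 ∎)
    1≤ : 1ℚ ℚ.≤ (r ∔ u) · (s ∔ u)
    1≤ = ^-cancel-≤ (ℚ.denominator-1 a) (0≤* (ℚ.+-mono-≤ 0≤r 0≤u) (ℚ.+-mono-≤ 0≤s 0≤u)) (begin
      1ℚ ^ℚ q                                 ≡⟨ 1^ q ⟩
      1ℚ                                      ≡⟨ ^ᶻ-inverse (↥ a) ⟨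
      base n ^ᶻ ↥ a · base n ^ᶻ (ℤ.- ↥ a)     ≤⟨ *-mono-nonNeg (^-nonNeg q (ℚ.+-mono-≤ 0≤r 0≤u)) (ℚ.<⇒≤ (^ᶻ-pos (ℤ.- ↥ a)))
                                                   (ℚ.<⇒≤ (powerFloor-upper a k)) (ℚ.<⇒≤ <s+u^q) ⟩
      (r ∔ u) ^ℚ q · (s ∔ u) ^ℚ q             ≡⟨ ^ℚ-distrib-* (r ∔ u) (s ∔ u) q ⟨
      ((r ∔ u) · (s ∔ u)) ^ℚ q                ∎)
    open +-*-Solver
    expand : ∀ r s u → (r ∔ u) · (s ∔ u) ≡ r · s ∔ (r ∔ s ∔ u) · u
    expand = solve 3 (λ r s u → (r :+ u) :* (s :+ u) := r :* s :+ (r :+ s :+ u) :* u) refl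
    lower : 1ℚ ℚ.≤ r · s ∔ (r ∔ s ∔ 1ℚ) · u
    lower = begin
      1ℚ                             ≤⟨ 1≤ ⟩
      (r ∔ u) · (s ∔ u)              ≡⟨ expand r s u ⟩
      r · s ∔ (r ∔ s ∔ u) · u        ≤⟨ ℚ.+-monoʳ-≤ (r · s) (*-monoʳ u 0≤u (ℚ.+-monoʳ-≤ (r ∔ s) (1/-anti {0} {k} ℕ.z≤n))) ⟩
      r · s ∔ (r ∔ s ∔ 1ℚ) · u       ∎
    upper : r · s ℚ.≤ 1ℚ ∔ (r ∔ s ∔ 1ℚ) · u
    upper = begin
      r · s                          ≤⟨ rs≤1 ⟩
      1ℚ                             ≤⟨ p≤q+p (0≤* (ℚ.+-mono-≤ (ℚ.+-mono-≤ 0≤r 0≤s) (0≤/ 1 0)) 0≤u) ⟩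
      (r ∔ s ∔ 1ℚ) · u ∔ 1ℚ          ≡⟨ ℚ.+-comm ((r ∔ s ∔ 1ℚ) · u) 1ℚ ⟩
      1ℚ ∔ (r ∔ s ∔ 1ℚ) · u          ∎

1/≤⇒denominator≤ : ∀ a K {p} → ↥ a ≡ + p → + 1 ℚ./ suc K ℚ.≤ a → ↧ₙ a ℕ.≤ p ℕ.* suc K
1/≤⇒denominator≤ a@(mkℚ _ d _) K {p} refl h = ℤ.drop‿+≤+ (subst₂ ℤ._≤_ (ℤ.*-identityˡ (+ suc d)) (sym (ℤ.pos-* p (suc K)))
  (ℚᵘ.drop-*≤* (ℚᵘ.≤-respˡ-≃ (ℚ.toℚᵘ-fromℚᵘ (mkℚᵘ (+ 1) K)) (ℚ.toℚᵘ-mono-≤ h))))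

-- If a = p/q, then p(K+1) = q + t with t ≥ 0, so r^q ≤ b^p yields
-- ((1+e)r)^(q(K+1)) ≤ ((1+e)^(K+1) b)^q b^t ≤ b′^q b′^t = b′^(p(K+1)).
powerFloor-gap : ∀ {n n′ e} K → 0ℚ ℚ.≤ e → (1ℚ ∔ e) ^ℚ suc K · base n ℚ.≤ base n′ →
  ∀ a k → + 1 ℚ./ suc K ℚ.≤ a → (1ℚ ∔ e) · powerFloor n a k ℚ.≤ powerFloor n′ a k ∔ (+ 1 ℚ./ suc k)
powerFloor-gap K 0≤e h a@(mkℚ -[1+ _ ] _ _) k K≤a = ⊥-elim (ℚ.<-asym (ℚ.<-≤-trans (0<1/ K) K≤a) (ℚ.negative⁻¹ a))
powerFloor-gap {n} {n′} {e} K 0≤e h a@(mkℚ (+ p) d _) k K≤a =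
  ^-cancel-≤ (ℕ.pred (q ℕ.* m)) (ℚ.+-mono-≤ (M.powerFloor-nonNeg a k) (0≤/ 1 k)) (begin
    ((1ℚ ∔ e) · r) ^ℚ (q ℕ.* m)             ≡⟨ ^ℚ-distrib-* (1ℚ ∔ e) r (q ℕ.* m) ⟩
    (1ℚ ∔ e) ^ℚ (q ℕ.* m) · r ^ℚ (q ℕ.* m)  ≡⟨ cong₂ (λ i w → (1ℚ ∔ e) ^ℚ i · w) (ℕ.*-comm q m) (sym (^ℚ-assocʳ r q m)) ⟩
    (1ℚ ∔ e) ^ℚ (m ℕ.* q) · (r ^ℚ q) ^ℚ m   ≡⟨ cong (_· (r ^ℚ q) ^ℚ m) (^ℚ-assocʳ (1ℚ ∔ e) m q) ⟨
    E ^ℚ q · (r ^ℚ q) ^ℚ m                  ≤⟨ *-monoˡ (E ^ℚ q) (^-nonNeg q 0≤E) (^-mono m (^-nonNeg q (L.powerFloor-nonNeg a k)) (L.powerFloor-lower a k)) ⟩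
    E ^ℚ q · (b ^ℚ p) ^ℚ m                  ≡⟨ cong (E ^ℚ q ·_) (split b) ⟩
    E ^ℚ q · (b ^ℚ q · b ^ℚ t)              ≡⟨ ℚ.*-assoc (E ^ℚ q) (b ^ℚ q) (b ^ℚ t) ⟨
    E ^ℚ q · b ^ℚ q · b ^ℚ t                ≡⟨ cong (_· b ^ℚ t) (^ℚ-distrib-* E b q) ⟨
    (E · b) ^ℚ q · b ^ℚ t                   ≤⟨ *-mono-nonNeg (^-nonNeg q 0≤b′) (^-nonNeg t 0≤b) (^-mono q (0≤* 0≤E 0≤b) h) (^-mono t 0≤b b≤b′) ⟩
    b′ ^ℚ q · b′ ^ℚ t                       ≡⟨ split b′ ⟨
    (b′ ^ℚ p) ^ℚ m                          ≤⟨ ^-mono m (^-nonNeg p 0≤b′) (ℚ.<⇒≤ (M.powerFloor-upper a k)) ⟩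
    (s ^ℚ q) ^ℚ m                           ≡⟨ ^ℚ-assocʳ s q m ⟩
    s ^ℚ (q ℕ.* m)                          ∎)
  where
  module L = PowerFloorLemmas n
  module M = PowerFloorLemmas n′
  m = suc K
  q = suc d
  t = p ℕ.* m ℕ.∸ q
  r = powerFloor n a k
  s = powerFloor n′ a k ∔ (+ 1 ℚ./ suc k)
  b = base n
  b′ = base n′
  E = (1ℚ ∔ e) ^ℚ m
  0≤b = 0≤/ (suc n) 0
  0≤b′ = 0≤/ (suc n′) 0
  1≤E : 1ℚ ℚ.≤ E
  1≤E = 1≤^ m (ℚ.≤-trans (p≤q+p 0≤e) (ℚ.≤-reflexive (ℚ.+-comm e 1ℚ)))
  0≤E = ℚ.≤-trans (0≤/ 1 0) 1≤E
  b≤b′ : b ℚ.≤ b′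
  b≤b′ = ℚ.≤-trans (ℚ.≤-reflexive (sym (ℚ.*-identityˡ b))) (ℚ.≤-trans (*-monoʳ b 0≤b 1≤E) h)
  split : ∀ c → (c ^ℚ p) ^ℚ m ≡ c ^ℚ q · c ^ℚ t
  split c = trans (^ℚ-assocʳ c p m) (trans
    (cong (c ^ℚ_) (sym (ℕ.m+[n∸m]≡n (1/≤⇒denominator≤ a K refl K≤a)))) (^ℚ-homo-* c q t))

-- Null, nonnegative and positive sequences of rationals.

-- For `seq x` the three predicates express x ≈ 0, 0 ≤ x and 0 < x. Being records, they do not
-- unfold, so the sequence can be inferred from the type of a proof.
record Null (f : ℕ → ℚ) : Set where
  constructor mkNull
  field null : ∀ ε → 0ℚ ℚ.< ε → Eventually λ n → ℚ.∣ f n ∣ ℚ.≤ ε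

record NonNeg (f : ℕ → ℚ) : Set where
  constructor mkNonNeg
  field nonNeg : ∀ ε → 0ℚ ℚ.< ε → Eventually λ n → 0ℚ ℚ.≤ f n ∔ ε

record Positive (f : ℕ → ℚ) : Set where
  constructor mkPositive
  field positive : ∃[ ε ] (0ℚ ℚ.< ε × Eventually λ n → ε ℚ.≤ f n)

open Null
open NonNeg
open Positive

eventually-map : ∀ {P Q} → (∀ n → P n → Q n) → Eventually P → Eventually Q
eventually-map f (N , p) = N , λ n N≤n → f n (p n N≤n)

eventually-zip : ∀ {P Q R} → (∀ n → P n → Q n → R n) → Eventually P → Eventually Q → Eventually R
eventually-zip f (M , p) (N , q) = M ℕ.⊔ N , λ n ≤n →
  f n (p n (ℕ.m⊔n≤o⇒m≤o M N ≤n)) (q n (ℕ.m⊔n≤o⇒n≤o M N ≤n))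

null-cong : ∀ {f g} → (∀ n → f n ≡ g n) → Null f → Null g
null-cong f≡g (mkNull h) = mkNull λ ε 0<ε →
  eventually-map (λ n → subst (λ w → ℚ.∣ w ∣ ℚ.≤ ε) (f≡g n)) (h ε 0<ε)

null-squeeze : ∀ {f g} → (∀ n → ℚ.∣ f n ∣ ℚ.≤ g n) → Null g → Null f
null-squeeze {g = g} f≤g (mkNull h) = mkNull λ ε 0<ε →
  eventually-map (λ n g≤ε → ℚ.≤-trans (f≤g n) (ℚ.≤-trans (p≤∣p∣ (g n)) g≤ε)) (h ε 0<ε)

eventually-zero⇒null : ∀ {f} → Eventually (λ n → f n ≡ 0ℚ) → Null f
eventually-zero⇒null h = mkNull λ ε 0<ε →
  eventually-map (λ n f≡0 → subst (λ w → ℚ.∣ w ∣ ℚ.≤ ε) (sym f≡0) (ℚ.<⇒≤ 0<ε)) h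

null-+ : ∀ {f g} → Null f → Null g → Null (λ n → f n ∔ g n)
null-+ {f} {g} (mkNull hf) (mkNull hg) = mkNull λ ε 0<ε →
  eventually-zip (λ n f≤ g≤ → begin
      ℚ.∣ f n ∔ g n ∣          ≤⟨ ℚ.∣p+q∣≤∣p∣+∣q∣ (f n) (g n) ⟩
      ℚ.∣ f n ∣ ∔ ℚ.∣ g n ∣    ≤⟨ ℚ.+-mono-≤ f≤ g≤ ⟩
      ½ · ε ∔ ½ · ε            ≡⟨ ½+½ ε ⟩
      ε                        ∎)
    (hf (½ · ε) (0<½* 0<ε)) (hg (½ · ε) (0<½* 0<ε))

-- The first factor is a real because its Cauchy property supplies the bound.
null-* : ∀ x {f} → Null f → Null (λ n → seq x n · f n)
null-* x {f} (mkNull h) = mkNull λ ε 0<ε →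
  let c , b = bounded (seq x) (isCauchy x)
      δ , 0<δ , small₁ = shrink (fromℕℚ (suc c)) 0<ε
  in eventually-zip (λ n x≤ f≤ → begin
      ℚ.∣ seq x n · f n ∣            ≡⟨ ℚ.∣p*q∣≡∣p∣*∣q∣ (seq x n) (f n) ⟩
      ℚ.∣ seq x n ∣ · ℚ.∣ f n ∣      ≤⟨ *-mono-nonNeg (0≤/ (suc c) 0) (ℚ.0≤∣p∣ (f n)) x≤ f≤ ⟩
      fromℕℚ (suc c) · δ             ≡⟨ ℚ.*-comm (fromℕℚ (suc c)) δ ⟩
      δ · fromℕℚ (suc c)             ≤⟨ small₁ ⟩
      ε                              ∎)
    b (h δ 0<δ)

null-1/ : Null (λ k → + 1 ℚ./ suc k)
null-1/ = mkNull λ ε 0<ε → let k , small₁ = small 0<ε in k , λ n k≤n → begin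
  ℚ.∣ + 1 ℚ./ suc n ∣   ≡⟨ ℚ.0≤p⇒∣p∣≡p (0≤/ 1 n) ⟩
  + 1 ℚ./ suc n         ≤⟨ 1/-anti k≤n ⟩
  + 1 ℚ./ suc k         ≤⟨ small₁ ⟩
  ε                     ∎

null-neg : ∀ {f} → Null f → Null (λ n → ℚ.- f n)
null-neg {f} (mkNull h) = mkNull λ ε 0<ε →
  eventually-map (λ n → subst (ℚ._≤ ε) (sym (ℚ.∣-p∣≡∣p∣ (f n)))) (h ε 0<ε)

null⇒nonNeg : ∀ {f} → Null f → NonNeg f
null⇒nonNeg {f} (mkNull h) = mkNonNeg λ ε 0<ε → eventually-map (λ n f≤ → begin
    0ℚ                  ≡⟨ ℚ.+-inverseʳ (f n) ⟨
    f n − f n           ≤⟨ ℚ.+-monoʳ-≤ (f n) (p≤∣p∣ (ℚ.- f n)) ⟩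
    f n ∔ ℚ.∣ ℚ.- f n ∣ ≡⟨ cong (f n ∔_) (ℚ.∣-p∣≡∣p∣ (f n)) ⟩
    f n ∔ ℚ.∣ f n ∣     ≤⟨ ℚ.+-monoʳ-≤ (f n) f≤ ⟩
    f n ∔ ε             ∎)
  (h ε 0<ε)

eventually-nonNeg : ∀ {f} → Eventually (λ n → 0ℚ ℚ.≤ f n) → NonNeg f
eventually-nonNeg h = mkNonNeg λ ε 0<ε → eventually-map (λ n 0≤f → ℚ.+-mono-≤ 0≤f (ℚ.<⇒≤ 0<ε)) h

positive⇒eventually-nonNeg : ∀ {f} → Positive f → Eventually (λ n → 0ℚ ℚ.≤ f n)
positive⇒eventually-nonNeg (mkPositive (ε , 0<ε , h)) = eventually-map (λ n → ℚ.≤-trans (ℚ.<⇒≤ 0<ε)) h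

positive⇒nonNeg : ∀ {f} → Positive f → NonNeg f
positive⇒nonNeg p = eventually-nonNeg (positive⇒eventually-nonNeg p)

nonNeg-+ : ∀ {f g} → NonNeg f → NonNeg g → NonNeg (λ n → f n ∔ g n)
nonNeg-+ {f} {g} (mkNonNeg hf) (mkNonNeg hg) = mkNonNeg λ ε 0<ε →
  eventually-zip (λ n 0≤f 0≤g → begin
      0ℚ                                    ≤⟨ ℚ.+-mono-≤ 0≤f 0≤g ⟩
      (f n ∔ ½ · ε) ∔ (g n ∔ ½ · ε)         ≡⟨ regroup (f n) (g n) (½ · ε) ⟩
      (f n ∔ g n) ∔ (½ · ε ∔ ½ · ε)         ≡⟨ cong ((f n ∔ g n) ∔_) (½+½ ε) ⟩
      (f n ∔ g n) ∔ ε                       ∎)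
    (hf (½ · ε) (0<½* 0<ε)) (hg (½ · ε) (0<½* 0<ε))
  where
  open +-*-Solver
  regroup : ∀ a b c → (a ∔ c) ∔ (b ∔ c) ≡ (a ∔ b) ∔ (c ∔ c)
  regroup = solve 3 (λ a b c → (a :+ c) :+ (b :+ c) := (a :+ b) :+ (c :+ c)) refl

-- The second factor is nonnegative only up to δ. The error `seq x n · δ` is kept below ε by an
-- upper bound on x.
nonNeg-* : ∀ x {f} → Eventually (λ n → 0ℚ ℚ.≤ seq x n) → NonNeg f → NonNeg (λ n → seq x n · f n)
nonNeg-* x {f} 0≤x (mkNonNeg h) = mkNonNeg λ ε 0<ε →
  let c , b = bounded-above (seq x) (isCauchy x)
      δ , 0<δ , small₁ = shrink (fromℕℚ (suc c)) 0<ε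
  in eventually-zip (λ n (0≤x , x≤) 0≤f+δ → begin
      0ℚ                                ≤⟨ 0≤* 0≤x 0≤f+δ ⟩
      seq x n · (f n ∔ δ)               ≡⟨ ℚ.*-distribˡ-+ (seq x n) (f n) δ ⟩
      seq x n · f n ∔ seq x n · δ       ≤⟨ ℚ.+-monoʳ-≤ (seq x n · f n) (*-monoʳ δ (ℚ.<⇒≤ 0<δ) x≤) ⟩
      seq x n · f n ∔ fromℕℚ (suc c) · δ ≡⟨ cong (seq x n · f n ∔_) (ℚ.*-comm (fromℕℚ (suc c)) δ) ⟩
      seq x n · f n ∔ δ · fromℕℚ (suc c) ≤⟨ ℚ.+-monoʳ-≤ (seq x n · f n) small₁ ⟩
      seq x n · f n ∔ ε                 ∎)
    (eventually-zip (λ _ → _,_) 0≤x b) (h δ 0<δ)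

positive-mono : ∀ {f g} → Eventually (λ n → f n ℚ.≤ g n) → Positive f → Positive g
positive-mono f≤g (mkPositive (ε , 0<ε , h)) = mkPositive (ε , 0<ε , eventually-zip (λ _ → ℚ.≤-trans) h f≤g)

positive-* : ∀ {f g} → Positive f → Positive g → Positive (λ n → f n · g n)
positive-* (mkPositive (ε , 0<ε , h)) (mkPositive (δ , 0<δ , k)) = mkPositive (ε · δ , 0<* 0<ε 0<δ ,
  eventually-zip (λ n ε≤f δ≤g → *-mono-nonNeg (ℚ.≤-trans (ℚ.<⇒≤ 0<ε) ε≤f) (ℚ.<⇒≤ 0<δ) ε≤f δ≤g) h k)

positive-nonNeg-+ : ∀ {f g} → Positive f → NonNeg g → Positive (λ n → f n ∔ g n)
positive-nonNeg-+ {f} {g} (mkPositive (ε , 0<ε , h)) (mkNonNeg k) = mkPositive (½ · ε , 0<½* 0<ε ,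
  eventually-zip (λ n ε≤f 0≤g → begin
      ½ · ε                               ≡⟨ plus-minus (½ · ε) (½ · ε) ⟨
      (½ · ε ∔ ½ · ε) − ½ · ε             ≤⟨ ≤⇒minus≤ (begin
        ½ · ε ∔ ½ · ε                       ≡⟨ trans (½+½ ε) (sym (ℚ.+-identityʳ ε)) ⟩
        ε ∔ 0ℚ                              ≤⟨ ℚ.+-mono-≤ ε≤f 0≤g ⟩
        f n ∔ (g n ∔ ½ · ε)                 ≡⟨ regroup (f n) (g n) (½ · ε) ⟩
        ½ · ε ∔ (f n ∔ g n)                 ∎) ⟩
      f n ∔ g n                           ∎)
    h (k (½ · ε) (0<½* 0<ε)))
  where
  open +-*-Solver
  regroup : ∀ a b c → a ∔ (b ∔ c) ≡ c ∔ (a ∔ b)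
  regroup = solve 3 (λ a b c → a :+ (b :+ c) := c :+ (a :+ b)) refl

nonNeg-positive-+ : ∀ {f g} → NonNeg f → Positive g → Positive (λ n → f n ∔ g n)
nonNeg-positive-+ {f} {g} hf hg =
  positive-mono (0 , λ n _ → ℚ.≤-reflexive (ℚ.+-comm (g n) (f n))) (positive-nonNeg-+ hg hf)

positive⇒¬null : ∀ {f} → Positive f → Null f → ⊥
positive⇒¬null {f} (mkPositive (ε , 0<ε , h)) (mkNull k) =
  let M , p = eventually-zip (λ n ε≤f ∣f∣≤ → begin-strict
          ½ · ε                ≡⟨ ℚ.+-identityʳ (½ · ε) ⟨
          ½ · ε ∔ 0ℚ           <⟨ ℚ.+-monoʳ-< (½ · ε) (0<½* 0<ε) ⟩
          ½ · ε ∔ ½ · ε        ≡⟨ ½+½ ε ⟩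
          ε                    ≤⟨ ε≤f ⟩
          f n                  ≤⟨ p≤∣p∣ (f n) ⟩
          ℚ.∣ f n ∣            ≤⟨ ∣f∣≤ ⟩
          ½ · ε                ∎)
        h (k (½ · ε) (0<½* 0<ε))
  in ℚ.<-irrefl refl (p M ℕ.≤-refl)

<⇒positive : ∀ {x} → 0ℝ < x → Positive (seq x)
<⇒positive {x} 0<x = mkPositive (positive-bound {x} 0<x)

-- Finite sums of sequences.

-- The counterpart of `∑` on bare sequences. No Cauchy proofs are carried along, so at a fixed index
-- it is an ordinary sum of rationals.
∑ˢ : {A : Set} → List A → (A → ℕ → ℚ) → ℕ → ℚ
∑ˢ xs f n = foldr (λ x s → f x n ∔ s) 0ℚ xs

seq-∑ : {A : Set} (xs : List A) (f : A → ℝ) (n : ℕ) → seq (∑ xs f) n ≡ ∑ˢ xs (λ x → seq (f x)) n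
seq-∑ []       f n = refl
seq-∑ (x ∷ xs) f n = cong (seq (f x) n ∔_) (seq-∑ xs f n)

∑-nonNeg : {A : Set} (xs : List A) (f : A → ℕ → ℚ) → (∀ x → NonNeg (f x)) → NonNeg (∑ˢ xs f)
∑-nonNeg []       f h = eventually-nonNeg (0 , λ _ _ → ℚ.≤-refl)
∑-nonNeg (x ∷ xs) f h = nonNeg-+ (h x) (∑-nonNeg xs f h)

∑-null : {A : Set} (xs : List A) (f : A → ℕ → ℚ) → (∀ x → Null (f x)) → Null (∑ˢ xs f)
∑-null []       f h = eventually-zero⇒null (0 , λ _ _ → refl)
∑-null (x ∷ xs) f h = null-+ (h x) (∑-null xs f h)

∑-any-positive : {A : Set} (xs : List A) (f : A → ℕ → ℚ) →
  (∀ x → NonNeg (f x)) → Any (λ x → Positive (f x)) xs → Positive (∑ˢ xs f)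
∑-any-positive (_ ∷ xs) f h (here p)  = positive-nonNeg-+ p (∑-nonNeg xs f h)
∑-any-positive (x ∷ xs) f h (there p) = nonNeg-positive-+ (h x) (∑-any-positive xs f h p)

∑-const : {A : Set} (xs : List A) (f : A → ℕ → ℚ) {n : ℕ} {c : ℚ} → (∀ x → f x n ≡ c) →
  ∑ˢ xs f n ≡ fromℕℚ (length xs) · c
∑-const []       f {c = c} h = sym (ℚ.*-zeroˡ c)
∑-const (x ∷ xs) f {n} {c} h = begin-equality
  f x n ∔ ∑ˢ xs f n                       ≡⟨ cong₂ _∔_ (h x) (∑-const xs f h) ⟩
  c ∔ fromℕℚ (length xs) · c              ≡⟨ cong (_∔ fromℕℚ (length xs) · c) (ℚ.*-identityˡ c) ⟨
  1ℚ · c ∔ fromℕℚ (length xs) · c         ≡⟨ ℚ.*-distribʳ-+ c 1ℚ (fromℕℚ (length xs)) ⟨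
  (1ℚ ∔ fromℕℚ (length xs)) · c           ≡⟨ cong (_· c) (fromℕℚ-suc (length xs)) ⟨
  fromℕℚ (suc (length xs)) · c            ∎

-- This sums the identity of one edge over all edges: r is the residual, f the ratio, g the
-- contribution B and h the defect, while c = 2Dt and d = Dt² do not depend on the edge.
∑-affine : {A : Set} (xs : List A) (r f g h : A → ℕ → ℚ) (c d : ℚ) (n : ℕ) →
  (∀ x → r x n ≡ f x n − ((c − d · g x n) ∔ h x n)) →
  ∑ˢ xs r n ≡ ∑ˢ xs f n − ((fromℕℚ (length xs) · c − d · ∑ˢ xs g n) ∔ ∑ˢ xs h n)
∑-affine []       r f g h c d n eq = empty c d
  where
  open +-*-Solver
  empty : ∀ c d → 0ℚ ≡ 0ℚ − ((0ℚ · c − d · 0ℚ) ∔ 0ℚ)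
  empty = solve 2 (λ c d → con 0ℚ := con 0ℚ :- ((con 0ℚ :* c :- d :* con 0ℚ) :+ con 0ℚ)) refl
∑-affine (x ∷ xs) r f g h c d n eq = begin-equality
  r x n ∔ ∑ˢ xs r n
    ≡⟨ cong₂ _∔_ (eq x) (∑-affine xs r f g h c d n eq) ⟩
  (f x n − ((c − d · g x n) ∔ h x n)) ∔ (∑ˢ xs f n − ((m · c − d · ∑ˢ xs g n) ∔ ∑ˢ xs h n))
    ≡⟨ regroup (f x n) (g x n) (h x n) c d (∑ˢ xs f n) (∑ˢ xs g n) (∑ˢ xs h n) m ⟩
  (f x n ∔ ∑ˢ xs f n) − (((1ℚ ∔ m) · c − d · (g x n ∔ ∑ˢ xs g n)) ∔ (h x n ∔ ∑ˢ xs h n))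
    ≡⟨ cong (λ w → (f x n ∔ ∑ˢ xs f n) − ((w · c − d · (g x n ∔ ∑ˢ xs g n)) ∔ (h x n ∔ ∑ˢ xs h n))) (fromℕℚ-suc (length xs)) ⟨
  (f x n ∔ ∑ˢ xs f n) − ((fromℕℚ (suc (length xs)) · c − d · (g x n ∔ ∑ˢ xs g n)) ∔ (h x n ∔ ∑ˢ xs h n)) ∎
  where
  m = fromℕℚ (length xs)
  open +-*-Solver
  regroup : ∀ f g h c d F G H m →
    (f − ((c − d · g) ∔ h)) ∔ (F − ((m · c − d · G) ∔ H))
    ≡ (f ∔ F) − (((1ℚ ∔ m) · c − d · (g ∔ G)) ∔ (h ∔ H))
  regroup = solve 9 (λ f g h c d F G H m →
    (f :- ((c :- d :* g) :+ h)) :+ (F :- ((m :* c :- d :* G) :+ H))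
    := (f :+ F) :- (((con 1ℚ :+ m) :* c :- d :* (g :+ G)) :+ (h :+ H))) refl

-- Inverses and real powers in the limit.

-- Once `seq x n` is above its positive lower bound, `inv` is the exact inverse and the difference
-- is 0.
÷-inverse : ∀ x (0<x : 0ℝ < x) → Null (λ n → seq (1ℝ ÷ x ⟨ 0<x ⟩) n · seq x n − 1ℚ)
÷-inverse x 0<x = let ε , 0<ε , h = positive-bound {x} 0<x in
  eventually-zero⇒null (eventually-map (λ n ε≤x → begin-equality
    1ℚ · inv (seq x n) · seq x n − 1ℚ   ≡⟨ cong (λ w → w · seq x n − 1ℚ) (ℚ.*-identityˡ (inv (seq x n))) ⟩
    inv (seq x n) · seq x n − 1ℚ        ≡⟨ cong (_− 1ℚ) (inv-inverse (ℚ.<-≤-trans 0<ε ε≤x)) ⟩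
    1ℚ − 1ℚ                             ≡⟨⟩
    0ℚ                                  ∎) h)

-- The two powers are rounded separately, so their product reaches 1 only in the limit; the error is
-- a bounded sequence times 1/(k+1).
^-neg-inverse : ∀ {b} α → 0 ℕ.< b → Null (λ n → seq (b ^ α) n · seq (b ^ (- α)) n − 1ℚ)
^-neg-inverse {suc b} α _ = null-squeeze (λ k → powerFloor-reciprocal b (seq α k) k)
  (null-* (suc b ^ α + suc b ^ (- α) + 1ℝ) null-1/)

^-nonneg : ∀ b α n → 0ℚ ℚ.≤ seq (b ^ α) n
^-nonneg zero    α n = ℚ.≤-refl
^-nonneg (suc b) α n = PowerFloorLemmas.powerFloor-nonNeg b (seq α n) n

-- Eventually α ≥ 1/(K+1), so the larger power exceeds the smaller one, r, by a factor 1 + e up to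
-- rounding. The difference is at least er - u, where er stays away from 0 and u = 1/(n+1) tends to
-- 0.
^-strictly-mono : ∀ {b c} α → 0ℝ < α → b ℕ.< c → Positive (λ n → seq (c ^ α) n − seq (b ^ α) n)
-- `zero ^ α` is 0, so positivity of the other power suffices.
^-strictly-mono {zero} {c} α 0<α b<c =
  positive-mono (0 , λ n _ → ℚ.≤-reflexive (sym (ℚ.+-identityʳ (seq (c ^ α) n)))) (<⇒positive {c ^ α} (^-positive α b<c))
^-strictly-mono {suc b} {suc c} α 0<α b<c =
  let ε , 0<ε , α-bound = positive-bound {α} 0<α
      K , K≤ε = small 0<ε
      e , 0<e , gap = root-gap (suc K) (ℕ.s<s⁻¹ b<c)
  in positive-mono
      (eventually-map (λ n ε≤α → let r = seq (suc b ^ α) n ; s = seq (suc c ^ α) n ; u = + 1 ℚ./ suc n in begin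
          e · r − u               ≡⟨ regroup e r u ⟩
          (1ℚ ∔ e) · r − (r ∔ u)  ≤⟨ ℚ.+-monoˡ-≤ (ℚ.- (r ∔ u)) (powerFloor-gap K (ℚ.<⇒≤ 0<e) gap (seq α n) n (ℚ.≤-trans K≤ε ε≤α)) ⟩
          (s ∔ u) − (r ∔ u)       ≡⟨ cancel r s u ⟩
          s − r                   ∎) α-bound)
      (positive-nonNeg-+
        (positive-* (mkPositive (e , 0<e , 0 , λ _ _ → ℚ.≤-refl)) (<⇒positive {suc b ^ α} (^-positive α (ℕ.s≤s ℕ.z≤n))))
        (null⇒nonNeg (null-neg null-1/)))
  where
  open +-*-Solver
  regroup : ∀ e r u → e · r − u ≡ (1ℚ ∔ e) · r − (r ∔ u)
  regroup = solve 3 (λ e r u → e :* r :- u := (con 1ℚ :+ e) :* r :- (r :+ u)) refl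
  cancel : ∀ r s u → (s ∔ u) − (r ∔ u) ≡ s − r
  cancel = solve 3 (λ r s u → (s :+ u) :- (r :+ u) := s :- r) refl

^-mono-≤ : ∀ {b c} α → 0ℝ < α → b ℕ.≤ c → NonNeg (λ n → seq (c ^ α) n − seq (b ^ α) n)
^-mono-≤ {b} α 0<α b≤c with ℕ.m≤n⇒m<n∨m≡n b≤c
... | inj₁ b<c  = positive⇒nonNeg (^-strictly-mono α 0<α b<c)
... | inj₂ refl = eventually-nonNeg (0 , λ n _ → ℚ.≤-reflexive (sym (ℚ.+-inverseʳ (seq (b ^ α) n))))

-- The decomposition for a single edge.

0≤square : ∀ p → 0ℚ ℚ.≤ p · p
0≤square p with ℚ.≤-total 0ℚ p
... | inj₁ 0≤p = 0≤* 0≤p 0≤p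
... | inj₂ p≤0 = subst (0ℚ ℚ.≤_) (neg-square p) (0≤* (ℚ.neg-antimono-≤ p≤0) (ℚ.neg-antimono-≤ p≤0))
  where
  open +-*-Solver
  neg-square : ∀ p → ℚ.- p · ℚ.- p ≡ p · p
  neg-square = solve 1 (λ p → :- p :* :- p := p :* p) refl

-- Since i - p = p(ix - 1) - i(xp - 1). It identifies the quotient 1/d^α with the power d^(-α).
inverse-unique : ∀ x i p → Null (λ n → seq i n · seq x n − 1ℚ) → Null (λ n → seq x n · seq p n − 1ℚ) →
  Null (λ n → seq i n − seq p n)
inverse-unique x i p ix xp = null-cong (λ n → regroup (seq x n) (seq i n) (seq p n))
  (null-+ (null-* p ix) (null-* (- i) xp))
  where
  open +-*-Solver
  regroup : ∀ x i p → p · (i · x − 1ℚ) ∔ ℚ.- i · (x · p − 1ℚ) ≡ i − p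
  regroup = solve 3 (λ x i p → p :* (i :* x :- con 1ℚ) :+ :- i :* (x :* p :- con 1ℚ) := i :- p) refl

-- The residual would be identically 0 if i, j and B were exactly the inverses
-- of x, y and i + j; as sequences they are so only in the limit.
module EdgeTerm (D t x y B : ℝ) (0<x : 0ℝ < x) (0<y : 0ℝ < y) where

  i j z defect residual : ℝ
  i = 1ℝ ÷ x ⟨ 0<x ⟩
  j = 1ℝ ÷ y ⟨ 0<y ⟩
  z = 1ℝ + - (t * B)
  defect = D * (i + j) * (z * z)
         + (fromℚ ½ * ((i + j) * ((x + - D) + (y + - D))) + fromℚ ½ * (((x + - y) * (x + - y)) * (i * j)))
  residual = (x ÷ y ⟨ 0<y ⟩ + y ÷ x ⟨ 0<x ⟩) + - ((D * (t + t) + - (D * (t * t) * B)) + defect)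

  -- The residual is a combination of B(i + j) - 1, ix - 1 and jy - 1, each of them null; `regroup`
  -- exhibits the Cauchy coefficients.
  residual-null : Null (λ n → seq B n · (seq i n ∔ seq j n) − 1ℚ) → Null (seq residual)
  residual-null B[i+j] = null-cong
      (λ n → sym (regroup (seq x n) (seq y n) (inv (seq x n)) (inv (seq y n)) (seq B n) (seq D n) (seq t n)))
      (null-+ (null-* (D * (t + t) + - (D * (t * t) * B)) B[i+j])
        (null-+ (null-* (fromℚ ½ + - (fromℚ ½ * (x * j))) (÷-inverse x 0<x))
                (null-* (fromℚ ½ + - (fromℚ ½ * (y * i)) + (i * x + - 1ℝ)) (÷-inverse y 0<y))))
    where
    open +-*-Solver
    -- Here i and j are the bare values of `inv`. The factors 1 come from unfolding `1ℝ ÷ x`,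
    -- whereas `x ÷ y` unfolds to x · j without one.
    regroup : ∀ x y i j B D t →
      (x · j ∔ y · i) ∔ ℚ.- ((D · (t ∔ t) ∔ ℚ.- (D · (t · t) · B))
        ∔ (D · (1ℚ · i ∔ 1ℚ · j) · ((1ℚ ∔ ℚ.- (t · B)) · (1ℚ ∔ ℚ.- (t · B)))
        ∔ (½ · ((1ℚ · i ∔ 1ℚ · j) · ((x ∔ ℚ.- D) ∔ (y ∔ ℚ.- D)))
        ∔ ½ · (((x ∔ ℚ.- y) · (x ∔ ℚ.- y)) · ((1ℚ · i) · (1ℚ · j))))))
      ≡ (D · (t ∔ t) ∔ ℚ.- (D · (t · t) · B)) · (B · (1ℚ · i ∔ 1ℚ · j) − 1ℚ)
        ∔ ((½ ∔ ℚ.- (½ · (x · (1ℚ · j)))) · (1ℚ · i · x − 1ℚ)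
        ∔ (½ ∔ ℚ.- (½ · (y · (1ℚ · i))) ∔ (1ℚ · i · x ∔ ℚ.- 1ℚ)) · (1ℚ · j · y − 1ℚ))
    regroup = solve 7 (λ x y i j B D t → let o = con 1ℚ ; h = con ½ in
      (x :* j :+ y :* i) :+ :- ((D :* (t :+ t) :+ :- (D :* (t :* t) :* B))
        :+ (D :* (o :* i :+ o :* j) :* ((o :+ :- (t :* B)) :* (o :+ :- (t :* B)))
        :+ (h :* ((o :* i :+ o :* j) :* ((x :+ :- D) :+ (y :+ :- D)))
        :+ h :* (((x :+ :- y) :* (x :+ :- y)) :* ((o :* i) :* (o :* j))))))
      := (D :* (t :+ t) :+ :- (D :* (t :* t) :* B)) :* (B :* (o :* i :+ o :* j) :- o)
        :+ ((h :+ :- (h :* (x :* (o :* j)))) :* (o :* i :* x :- o)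
        :+ (h :+ :- (h :* (y :* (o :* i))) :+ (o :* i :* x :+ :- o)) :* (o :* j :* y :- o))) refl

  private
    i-positive : Positive (seq i)
    i-positive = <⇒positive {i} (1÷-positive {x} 0<x)

    j-positive : Positive (seq j)
    j-positive = <⇒positive {j} (1÷-positive {y} 0<y)

    i+j-positive : Positive (seq (i + j))
    i+j-positive = positive-nonNeg-+ i-positive (positive⇒nonNeg j-positive)

    ½-nonNeg : Eventually (λ n → 0ℚ ℚ.≤ seq (fromℚ ½) n)
    ½-nonNeg = 0 , λ _ _ → ℚ.nonNegative⁻¹ ½

    mismatch-nonNeg : NonNeg (seq (fromℚ ½ * (((x + - y) * (x + - y)) * (i * j))))
    mismatch-nonNeg = nonNeg-* (fromℚ ½) ½-nonNeg (nonNeg-* ((x + - y) * (x + - y))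
      (0 , λ n _ → 0≤square (seq (x + - y) n)) (positive⇒nonNeg (positive-* i-positive j-positive)))

  module _ (0≤D : ∀ n → 0ℚ ℚ.≤ seq D n) where

    private
      spread-nonNeg : NonNeg (seq (D * (i + j) * (z * z)))
      spread-nonNeg = nonNeg-* (D * (i + j))
        (eventually-map (λ n → 0≤* (0≤D n)) (positive⇒eventually-nonNeg i+j-positive))
        (eventually-nonNeg (0 , λ n _ → 0≤square (seq z n)))

    defect-nonNeg : NonNeg (λ n → seq x n − seq D n) → NonNeg (λ n → seq y n − seq D n) → NonNeg (seq defect)
    defect-nonNeg D≤x D≤y = nonNeg-+ spread-nonNeg (nonNeg-+
      (nonNeg-* (fromℚ ½) ½-nonNeg (nonNeg-* (i + j) (positive⇒eventually-nonNeg i+j-positive) (nonNeg-+ D≤x D≤y)))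
      mismatch-nonNeg)

    defect-positive : Positive (λ n → (seq x n − seq D n) ∔ (seq y n − seq D n)) → Positive (seq defect)
    defect-positive p = nonNeg-positive-+ spread-nonNeg (positive-nonNeg-+
      (positive-* (mkPositive (½ , ℚ.positive⁻¹ ½ , 0 , λ _ _ → ℚ.≤-refl)) (positive-* i+j-positive p))
      mismatch-nonNeg)

  -- With x and y both replaced by D, the last two parts of the defect cancel identically and D(i +
  -- j)z² remains.
  defect-null : x ≡ D → y ≡ D → Null (seq z) → Null (seq defect)
  defect-null refl refl z-null = null-cong
      (λ n → sym (collapse (seq D n) (seq i n) (seq j n) (seq z n)))
      (null-* (D * (i + j) * z) z-null)
    where
    open +-*-Solver
    collapse : ∀ D i j z →
      D · (i ∔ j) · (z · z) ∔ (½ · ((i ∔ j) · ((D ∔ ℚ.- D) ∔ (D ∔ ℚ.- D))) ∔ ½ · (((D ∔ ℚ.- D) · (D ∔ ℚ.- D)) · (i · j)))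
      ≡ D · (i ∔ j) · z · z
    collapse = solve 4 (λ D i j z →
      D :* (i :+ j) :* (z :* z) :+ (con ½ :* ((i :+ j) :* ((D :+ :- D) :+ (D :+ :- D))) :+ con ½ :* (((D :+ :- D) :* (D :+ :- D)) :* (i :* j)))
      := D :* (i :+ j) :* z :* z) refl

-- Summation over an abstract list of edges.

-- With S the sum of the B, `σ` plays 1/S and `t` plays m/S, the value at which 2tm - t²S is
-- largest.
module WeightedEdges {E : Set} (edges : List E) (D σ t : ℝ) (x y B : E → ℝ)
  (0<x : ∀ e → 0ℝ < x e) (0<y : ∀ e → 0ℝ < y e)
  (σ-inverse : Null (λ k → seq σ k · ∑ˢ edges (λ e → seq (B e)) k − 1ℚ))
  (t≡mσ : ∀ k → seq t k ≡ fromℕℚ (length edges) · seq σ k) where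

  private
    m : ℚ
    m = fromℕℚ (length edges)

  module Term (e : E) = EdgeTerm D t (x e) (y e) (B e) (0<x e) (0<y e)

  ratio : E → ℝ
  ratio e = x e ÷ y e ⟨ 0<y e ⟩ + y e ÷ x e ⟨ 0<x e ⟩

  ratios defects : ℕ → ℚ
  ratios = ∑ˢ edges (λ e → seq (ratio e))
  defects = ∑ˢ edges (λ e → seq (Term.defect e))

  -- The residuals sum to a null sequence, which gives the main part as D(2tm - t²S). Substituting t
  -- = mσ and adding -Dm²σ(σS - 1), null as well, turns it into Dm²σ.
  ratios-decomposition : (∀ e → Null (λ k → seq (B e) k · (seq (Term.i e) k ∔ seq (Term.j e) k) − 1ℚ)) →
    Null (λ k → ratios k − (seq D k · (m · m) · seq σ k ∔ defects k))
  ratios-decomposition B[i+j] = null-cong pointwise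
      (null-+ (∑-null edges (λ e → seq (Term.residual e)) (λ e → Term.residual-null e (B[i+j] e)))
              (null-* (- (D * fromℚ m * fromℚ m * σ)) σ-inverse))
    where
    open +-*-Solver
    collect : ∀ A D σ S T {t m} → t ≡ m · σ →
      (A − ((m · (D · (t ∔ t)) − D · (t · t) · S) ∔ T)) ∔ ℚ.- (D · m · m · σ) · (σ · S − 1ℚ)
      ≡ A − (D · (m · m) · σ ∔ T)
    collect A D σ S T {m = m} refl = solve 6 (λ A D m σ S T →
      (A :- ((m :* (D :* (m :* σ :+ m :* σ)) :- D :* (m :* σ :* (m :* σ)) :* S) :+ T)) :+ :- (D :* m :* m :* σ) :* (σ :* S :- con 1ℚ)
      := A :- (D :* (m :* m) :* σ :+ T)) refl A D m σ S T

    pointwise : ∀ k →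
      ∑ˢ edges (λ e → seq (Term.residual e)) k ∔ ℚ.- (seq D k · m · m · seq σ k) · (seq σ k · ∑ˢ edges (λ e → seq (B e)) k − 1ℚ)
      ≡ ratios k − (seq D k · (m · m) · seq σ k ∔ defects k)
    pointwise k = trans
      (cong (_∔ ℚ.- (seq D k · m · m · seq σ k) · (seq σ k · ∑ˢ edges (λ e → seq (B e)) k − 1ℚ))
        (∑-affine edges (λ e → seq (Term.residual e)) (λ e → seq (ratio e)) (λ e → seq (B e)) (λ e → seq (Term.defect e))
          (seq (D * (t + t)) k) (seq (D * (t * t)) k) k (λ _ → refl)))
      (collect (ratios k) (seq D k) (seq σ k) (∑ˢ edges (λ e → seq (B e)) k) (defects k) (t≡mσ k))

  -- If every B equals c, then S = mc and z = 1 - mσc = -(σS - 1), which is null.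
  defects-null : {c : ℕ → ℚ} → (∀ e → x e ≡ D) → (∀ e → y e ≡ D) → (∀ k e → seq (B e) k ≡ c k) → Null defects
  defects-null {c} x≡D y≡D B≡c = ∑-null edges (λ e → seq (Term.defect e)) λ e →
      Term.defect-null e (x≡D e) (y≡D e) (null-cong (pointwise e) (null-neg σ-inverse))
    where
    open +-*-Solver
    rearrange : ∀ σ m c → ℚ.- (σ · (m · c) − 1ℚ) ≡ 1ℚ ∔ ℚ.- (m · σ · c)
    rearrange = solve 3 (λ σ m c → :- (σ :* (m :* c) :- con 1ℚ) := con 1ℚ :+ :- (m :* σ :* c)) refl

    pointwise : ∀ e k → ℚ.- (seq σ k · ∑ˢ edges (λ e → seq (B e)) k − 1ℚ) ≡ seq (Term.z e) k
    pointwise e k = begin-equality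
      ℚ.- (seq σ k · ∑ˢ edges (λ e → seq (B e)) k − 1ℚ)     ≡⟨ cong (λ w → ℚ.- (seq σ k · w − 1ℚ)) (∑-const edges (λ e → seq (B e)) (B≡c k)) ⟩
      ℚ.- (seq σ k · (m · c k) − 1ℚ)             ≡⟨ rearrange (seq σ k) m (c k) ⟩
      1ℚ ∔ ℚ.- (m · seq σ k · c k)               ≡⟨ cong₂ (λ v w → 1ℚ ∔ ℚ.- (v · w)) (t≡mσ k) (B≡c k e) ⟨
      1ℚ ∔ ℚ.- (seq t k · seq (B e) k)           ∎

  module _ (0≤D : ∀ n → 0ℚ ℚ.≤ seq D n)
    (D≤x : ∀ e → NonNeg (λ n → seq (x e) n − seq D n)) (D≤y : ∀ e → NonNeg (λ n → seq (y e) n − seq D n)) where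

    private
      defect-nonNeg : ∀ e → NonNeg (seq (Term.defect e))
      defect-nonNeg e = Term.defect-nonNeg e 0≤D (D≤x e) (D≤y e)

    defects-nonNeg : NonNeg defects
    defects-nonNeg = ∑-nonNeg edges (λ e → seq (Term.defect e)) defect-nonNeg

    defects-positive : Any (λ e → Positive (λ n → (seq (x e) n − seq D n) ∔ (seq (y e) n − seq D n))) edges → Positive defects
    defects-positive p = ∑-any-positive edges (λ e → seq (Term.defect e)) defect-nonNeg
      (Any.map (λ {e} → Term.defect-positive e 0≤D) p)

-- Locating an edge at a given vertex.

module _ {n : ℕ} (G : Graph n) where
  open Graph G

  -- The edge found carries the proofs produced by the decision procedures, not the given ones, so P
  -- is required of every edge with these endpoints.
  edge?-any : ∀ {u v} {P : Edge → Set} → u Fin.< v → u ~ v →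
    (∀ e → Edge.fst e ≡ u → Edge.snd e ≡ v → P e) → MAny.Any P (edge? (u , v))
  edge?-any {u} {v} u<v u~v h with (u Fin.<? v) ×-dec (u ~? v)
  ... | yes (u<v′ , u~v′) = just (h (edge u v u<v′ u~v′) refl refl)
  ... | no  ¬p            = ⊥-elim (¬p (u<v , u~v))

  edges-any-ordered : ∀ {u v} {P : Edge → Set} → u Fin.< v → u ~ v →
    (∀ e → Edge.fst e ≡ u → Edge.snd e ≡ v → P e) → Any P edges
  edges-any-ordered {u} {v} u<v u~v h = Any.mapMaybe⁺ edge? (cartesianProduct (allFin n) (allFin n))
    (Any.map⁺ (lose (∈-cartesianProduct⁺ (∈-allFin u) (∈-allFin v)) (edge?-any u<v u~v h)))

  -- An edge is stored with its smaller endpoint first, so u can occur in either position.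
  edges-any : ∀ {u v} {P : Edge → Set} → u ~ v → (∀ e → Edge.fst e ≡ u ⊎ Edge.snd e ≡ u → P e) → Any P edges
  edges-any {u} {v} u~v h with Fin.<-cmp u v
  ... | tri< u<v _ _  = edges-any-ordered u<v u~v λ e p _ → h e (inj₁ p)
  ... | tri≈ _ refl _ = ⊥-elim (~-irr u~v)
  ... | tri> _ _ v<u  = edges-any-ordered v<u (~-sym u~v) λ e _ p → h e (inj₂ p)

  neighbour : ∀ u → 0 ℕ.< degree u → ∃[ v ] u ~ v
  neighbour u 0<d with filter (u ~?_) (allFin n) in eq
  ... | []    = ⊥-elim (ℕ.<-irrefl refl 0<d)
  ... | v ∷ _ = v , proj₂ (∈-filter⁻ (u ~?_) {xs = allFin n} (subst (λ vs → Any (v ≡_) vs) (sym eq) (here refl)))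

-- The decomposition applied to the edges of a graph.

module SDDBound {n : ℕ} (G : Graph n) (δ : ℕ) (α : ℝ) (m≥1 : 1 ℕ.≤ Graph.size G) where
  open Graph G

  D σ t bound : ℝ
  D = δ ^ α
  σ = 1ℝ ÷ ISD (- α) ⟨ ISD-positive (- α) m≥1 ⟩
  t = fromℕ size * σ
  bound = (D * fromℕ (size ℕ.^ 2)) ÷ ISD (- α) ⟨ ISD-positive (- α) m≥1 ⟩

  term : Edge → ℝ
  term e = 1ℝ ÷ (dᵤ^ (- α) e + dᵥ^ (- α) e) ⟨ 0<dᵤ^+dᵥ^ (- α) e ⟩

  σ-inverse : Null (λ k → seq σ k · ∑ˢ edges (λ e → seq (term e)) k − 1ℚ)
  σ-inverse = null-cong
    (λ k → cong (λ w → seq σ k · w − 1ℚ)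
      (seq-∑ edges (λ e → 1ℝ ÷ (dᵤ^ (- α) e + dᵥ^ (- α) e) ⟨ 0<dᵤ^+dᵥ^ (- α) e ⟩) k))
    (÷-inverse (ISD (- α)) (ISD-positive (- α) m≥1))

  module W = WeightedEdges edges D σ t (dᵤ^ α) (dᵥ^ α) term (0<dᵤ^ α) (0<dᵥ^ α) σ-inverse (λ _ → refl)

  -- `term e` inverts the sum of the two powers with exponent -α, and these agree in the limit with
  -- the quotients i and j.
  term-inverse : ∀ e → Null (λ k → seq (term e) k · (seq (W.Term.i e) k ∔ seq (W.Term.j e) k) − 1ℚ)
  term-inverse e = null-cong
      (λ k → regroup (seq (term e) k) (seq (W.Term.i e) k) (seq (W.Term.j e) k) (seq (dᵤ^ (- α) e) k) (seq (dᵥ^ (- α) e) k))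
      (null-+ (÷-inverse (dᵤ^ (- α) e + dᵥ^ (- α) e) (0<dᵤ^+dᵥ^ (- α) e))
        (null-* (term e) (null-+
          (inverse-unique (dᵤ^ α e) (W.Term.i e) (dᵤ^ (- α) e) (÷-inverse (dᵤ^ α e) (0<dᵤ^ α e))
            (^-neg-inverse α (~⇒degree>0 (Edge.adjacent e))))
          (inverse-unique (dᵥ^ α e) (W.Term.j e) (dᵥ^ (- α) e) (÷-inverse (dᵥ^ α e) (0<dᵥ^ α e))
            (^-neg-inverse α (~⇒degree>0 (~-sym (Edge.adjacent e))))))))
    where
    open +-*-Solver
    regroup : ∀ B i j p q → (B · (p ∔ q) − 1ℚ) ∔ B · ((i − p) ∔ (j − q)) ≡ B · (i ∔ j) − 1ℚ
    regroup = solve 5 (λ B i j p q → (B :* (p :+ q) :- con 1ℚ) :+ B :* ((i :- p) :+ (j :- q)) := B :* (i :+ j) :- con 1ℚ) refl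

  SDD-decomposition : Null (λ k → seq (SDD α) k − (seq bound k ∔ W.defects k))
  SDD-decomposition = null-cong
      (λ k → cong₂ (λ v w → v − (w ∔ W.defects k)) (sym (ratios k)) (bound≡ k))
      (W.ratios-decomposition term-inverse)
    where
    ratios : ∀ k → seq (SDD α) k ≡ W.ratios k
    ratios = seq-∑ edges λ e → dᵤ^ α e ÷ dᵥ^ α e ⟨ 0<dᵥ^ α e ⟩ + dᵥ^ α e ÷ dᵤ^ α e ⟨ 0<dᵤ^ α e ⟩

    open +-*-Solver
    -- `m · (m · 1ℚ)` is the unfolded square, and `1ℚ · s` is the unfolded `σ`.
    drop-units : ∀ D m s → D · (m · m) · (1ℚ · s) ≡ D · (m · (m · 1ℚ)) · s
    drop-units = solve 3 (λ D m s → D :* (m :* m) :* (con 1ℚ :* s) := D :* (m :* (m :* con 1ℚ)) :* s) refl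

    bound≡ : ∀ k → seq D k · (fromℕℚ size · fromℕℚ size) · seq σ k ≡ seq bound k
    bound≡ k = trans (drop-units (seq D k) (fromℕℚ size) (inv (seq (ISD (- α)) k)))
      (cong (λ w → seq D k · w · inv (seq (ISD (- α)) k)) (sym (fromℕℚ-^ size 2)))

  module _ (minimal : ∀ v → δ ℕ.≤ degree v) (0<α : 0ℝ < α) where

    D≤dᵤ^ : ∀ e → NonNeg (λ k → seq (dᵤ^ α e) k − seq D k)
    D≤dᵤ^ e = ^-mono-≤ {δ} {degree (Edge.fst e)} α 0<α (minimal (Edge.fst e))

    D≤dᵥ^ : ∀ e → NonNeg (λ k → seq (dᵥ^ α e) k − seq D k)
    D≤dᵥ^ e = ^-mono-≤ {δ} {degree (Edge.snd e)} α 0<α (minimal (Edge.snd e))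

    D<dᵤ^ : ∀ e → δ ℕ.< degree (Edge.fst e) → Positive (λ k → seq (dᵤ^ α e) k − seq D k)
    D<dᵤ^ e = ^-strictly-mono {δ} {degree (Edge.fst e)} α 0<α

    D<dᵥ^ : ∀ e → δ ℕ.< degree (Edge.snd e) → Positive (λ k → seq (dᵥ^ α e) k − seq D k)
    D<dᵥ^ e = ^-strictly-mono {δ} {degree (Edge.snd e)} α 0<α

    exceeds : ∀ {u} → δ ℕ.< degree u → ∀ e → Edge.fst e ≡ u ⊎ Edge.snd e ≡ u →
      Positive (λ k → (seq (dᵤ^ α e) k − seq D k) ∔ (seq (dᵥ^ α e) k − seq D k))
    exceeds δ<d e (inj₁ refl) = positive-nonNeg-+ (D<dᵤ^ e δ<d) (D≤dᵥ^ e)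
    exceeds δ<d e (inj₂ refl) = nonNeg-positive-+ (D≤dᵤ^ e) (D<dᵥ^ e δ<d)

    -- A degree above δ is positive, so the vertex lies on some edge. The defect of that edge is
    -- positive and makes the whole sum positive.
    defects-null⇒degree≡δ : Null W.defects → ∀ u → degree u ≡ δ
    defects-null⇒degree≡δ null u = [ absurd , sym ]′ (ℕ.m≤n⇒m<n∨m≡n (minimal u))
      where
      absurd : δ ℕ.< degree u → degree u ≡ δ
      absurd δ<d = let v , u~v = neighbour G u (ℕ.≤-<-trans ℕ.z≤n δ<d) in
        ⊥-elim (positive⇒¬null (W.defects-positive (^-nonneg δ α) D≤dᵤ^ D≤dᵥ^ (edges-any G u~v (exceeds δ<d))) null)

  degree≡δ⇒defects-null : (∀ u → degree u ≡ δ) → Null W.defects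
  degree≡δ⇒defects-null d≡δ = W.defects-null
    -- The common contribution of all edges, 1/(2δ^(-α)).
    {λ k → 1ℚ · inv (seq (δ ^ (- α)) k ∔ seq (δ ^ (- α)) k)}
    (λ e → cong (_^ α) (d≡δ (Edge.fst e)))
    (λ e → cong (_^ α) (d≡δ (Edge.snd e)))
    (λ k e → cong₂ (λ c d → 1ℚ · inv (seq (c ^ (- α)) k ∔ seq (d ^ (- α)) k))
      (d≡δ (Edge.fst e)) (d≡δ (Edge.snd e)))

-- The inequality and the case of equality.

theorem4 : ∀ {n : ℕ} (G : Graph n) (δ : ℕ) (α : ℝ) (m≥1 : 1 ℕ.≤ Graph.size G) →
    Graph.IsMinDegree G δ → 0ℝ < α →
    let bound = (δ ^ α * fromℕ (Graph.size G ℕ.^ 2))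
                  ÷ Graph.ISD G (- α) ⟨ Graph.ISD-positive G (- α) m≥1 ⟩
    in (bound ≤ Graph.SDD G α) × ((Graph.SDD G α ≈ bound) ⇔ Graph.Regular G)
theorem4 G δ α m≥1 (minimal , v , dv≡δ) 0<α = bound≤SDD , mk⇔ equality⇒regular regular⇒equality
  where
  open Graph G
  open SDDBound G δ α m≥1
  open +-*-Solver

  bound≤SDD : bound ≤ SDD α
  bound≤SDD ε 0<ε = eventually-map (λ k 0≤ → begin
      seq bound k                  ≡⟨ ℚ.+-identityˡ (seq bound k) ⟨
      0ℚ ∔ seq bound k             ≤⟨ ℚ.+-monoˡ-≤ (seq bound k) 0≤ ⟩
      (seq (SDD α) k − (seq bound k ∔ W.defects k)) ∔ W.defects k ∔ ε ∔ seq bound k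
                                   ≡⟨ regroup (seq (SDD α) k) (seq bound k) (W.defects k) ε ⟩
      seq (SDD α) k ∔ ε            ∎)
    (nonNeg (nonNeg-+ (null⇒nonNeg SDD-decomposition)
      (W.defects-nonNeg (^-nonneg δ α) (D≤dᵤ^ minimal 0<α) (D≤dᵥ^ minimal 0<α))) ε 0<ε)
    where
    regroup : ∀ x y d ε → (x − (y ∔ d)) ∔ d ∔ ε ∔ y ≡ x ∔ ε
    regroup = solve 4 (λ x y d ε → (x :- (y :+ d)) :+ d :+ ε :+ y := x :+ ε) refl

  equality⇒regular : SDD α ≈ bound → Regular
  equality⇒regular SDD≈bound u w = trans (d≡δ u) (sym (d≡δ w))
    where
    isolate : ∀ x y d → (x − y) ∔ ℚ.- (x − (y ∔ d)) ≡ d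
    isolate = solve 3 (λ x y d → (x :- y) :+ :- (x :- (y :+ d)) := d) refl

    d≡δ : ∀ u → degree u ≡ δ
    d≡δ = defects-null⇒degree≡δ minimal 0<α
      -- Equality makes SDD - bound null; subtracting the null sequence SDD - (bound + defects)
      -- leaves the defects.
      (null-cong (λ k → isolate (seq (SDD α) k) (seq bound k) (W.defects k))
        (null-+ (mkNull SDD≈bound) (null-neg SDD-decomposition)))

  regular⇒equality : Regular → SDD α ≈ bound
  regular⇒equality regular = null (null-cong (λ k → add-back (seq (SDD α) k) (seq bound k) (W.defects k))
    -- The vertex `v` attains the minimum, so regularity gives every vertex degree δ.
    (null-+ SDD-decomposition (degree≡δ⇒defects-null λ u → trans (regular u v) dv≡δ)))
    where
    add-back : ∀ x y d → (x − (y ∔ d)) ∔ d ≡ x − y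
    add-back = solve 3 (λ x y d → (x :- (y :+ d)) :+ d := x :- y) refl
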